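{- Let $G$ be a connected cograph of order $n \ge 3$. Then $M_G\geq \tfrac{n}{2}+\tfrac{1}{3\cdot 2^{n-2}}$, with equality if and only if $G\cong S_n$.
   Context: All graphs are finite and simple; the order of a graph is its number of vertices. A graph is a cograph if it contains no induced path on $4$ vertices. For a graph $G$ of order $n$, let $a_k(G)$ be the number of $k$-element vertex subsets of $G$ that induce a connected subgraph (single vertices count as connected), and let $\Phi_G(x)=\sum_{k=1}^n a_k(G)x^k$. The global mean of $G$ is $M_G=\Phi_G'(1)/\Phi_G(1)$. $G_1\cup G_2$ denotes the disjoint union and $G_1+G_2$ the join of graphs (the disjoint union together with all edges between $G_1$ and $G_2$). For $n\ge 3$, the $n$-skillet is $S_n=K_1+(K_1\cup K_{n-2})$. -}

module Defs where

open import Data.Bool using (Bool; true; false; not; _∨_; T)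
open import Data.Bool.Properties using (∨-comm; T?)
open import Data.Fin using (Fin; zero; toℕ; splitAt)
import Data.Fin.Properties as Fin
open import Data.Fin.Subset using (Subset; inside; outside; ⁅_⁆; ∣_∣; ⊤; Nonempty; _∈_)
open import Data.Fin.Subset.Properties using (_∈?_; nonempty?; x∈⁅x⁆; x∈⁅y⁆⇒x≡y; ∣⁅x⁆∣≡1)
open import Data.Integer using (+_)
open import Data.List using (List; []; _∷_; _++_; map; length; filter; zipWith; applyUpTo; allFin)
open import Data.List.Membership.Propositional using () renaming (_∈_ to _∈ₗ_)
open import Data.List.Membership.Propositional.Properties
  using (∈-++⁺ˡ; ∈-++⁺ʳ; ∈-map⁺; ∈-filter⁺; ∈-length; ∈-allFin)
open import Data.List.Relation.Unary.Any using (here; there)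
open import Data.Nat using (ℕ; suc; _+_; _*_; _∸_; _≟_; _<_; NonZero; >-nonZero)
open import Data.Nat.Properties using (1+n≢n; m≤m+n; ≤-trans)
open import Data.Product using (_×_; _,_)
open import Data.Rational using (ℚ; _/_)
open import Data.Sum using (_⊎_; inj₁; inj₂)
open import Data.Vec using ([]; _∷_)
open import Function.Bundles using (_↔_; Inverse)
open import Function.Definitions using (Injective)
open import Level using (0ℓ)
open import Relation.Binary using (Rel; Decidable)
open import Relation.Binary.Construct.Closure.ReflexiveTransitive using (Star; ε; _◅_; _◅◅_)
open import Relation.Binary.PropositionalEquality
  using (_≡_; refl; sym; cong₂)
open import Relation.Nullary using (¬_; Dec; yes; no; does; contradiction)
open import Relation.Nullary.Decidable using (map′; dec-false; _×-dec_; _⊎-dec_; _→-dec_)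

record Graph (n : ℕ) : Set where
  field
    adj        : Fin n → Fin n → Bool
    adj-sym    : ∀ u v → adj u v ≡ adj v u
    adj-irrefl : ∀ u → adj u u ≡ false

open Graph public

infix 4 _≅_

record _≅_ {m n : ℕ} (G : Graph m) (H : Graph n) : Set where
  field
    bijection : Fin m ↔ Fin n
    preserves : ∀ u v → adj H (Inverse.to bijection u) (Inverse.to bijection v) ≡ adj G u v

-- preserves is an equation, so non-edges are preserved as well as edges.
record Induced {m n : ℕ} (H : Graph m) (G : Graph n) : Set where
  field
    embed     : Fin m → Fin n
    injective : Injective _≡_ _≡_ embed
    preserves : ∀ u v → adj G (embed u) (embed v) ≡ adj H u v

K : (n : ℕ) → Graph n
K n .adj u v = not (does (u Fin.≟ v))
K n .adj-sym u v with u Fin.≟ v | v Fin.≟ u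
... | yes _  | yes _  = refl
... | no _   | no _   = refl
... | yes p  | no ¬q  = contradiction (sym p) ¬q
... | no ¬p  | yes q  = contradiction (sym q) ¬p
K n .adj-irrefl u with u Fin.≟ u
... | yes _ = refl
... | no ¬p = contradiction refl ¬p

path : (n : ℕ) → Graph n
path n .adj u v = does (suc (toℕ u) ≟ toℕ v) ∨ does (suc (toℕ v) ≟ toℕ u)
path n .adj-sym u v = ∨-comm (does (suc (toℕ u) ≟ toℕ v)) _
path n .adj-irrefl u = cong₂ _∨_ 1+u≠u 1+u≠u
  where
  1+u≠u : does (suc (toℕ u) ≟ toℕ u) ≡ false
  1+u≠u = dec-false (suc (toℕ u) ≟ toℕ u) 1+n≢n

-- The vertices of both graphs side by side; every cross pair gets adjacency b.
combine : ∀ {m n} → Bool → Graph m → Graph n → Graph (m + n)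
combine {m} {n} b G H = record
  { adj        = λ u v → adj⊎ (splitAt m u) (splitAt m v)
  ; adj-sym    = λ u v → adj⊎-sym (splitAt m u) (splitAt m v)
  ; adj-irrefl = λ u → adj⊎-irrefl (splitAt m u)
  }
  where
  adj⊎ : Fin m ⊎ Fin n → Fin m ⊎ Fin n → Bool
  adj⊎ (inj₁ u) (inj₁ v) = adj G u v
  adj⊎ (inj₂ u) (inj₂ v) = adj H u v
  adj⊎ (inj₁ _) (inj₂ _) = b
  adj⊎ (inj₂ _) (inj₁ _) = b

  adj⊎-sym : ∀ x y → adj⊎ x y ≡ adj⊎ y x
  adj⊎-sym (inj₁ u) (inj₁ v) = adj-sym G u v
  adj⊎-sym (inj₂ u) (inj₂ v) = adj-sym H u v
  adj⊎-sym (inj₁ _) (inj₂ _) = refl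
  adj⊎-sym (inj₂ _) (inj₁ _) = refl

  adj⊎-irrefl : ∀ x → adj⊎ x x ≡ false
  adj⊎-irrefl (inj₁ u) = adj-irrefl G u
  adj⊎-irrefl (inj₂ u) = adj-irrefl H u

infixr 6 _⊍_ _⋈_

-- ⊍ is disjoint union; ⋈ is the join, usually written +.
_⊍_ _⋈_ : ∀ {m n} → Graph m → Graph n → Graph (m + n)
_⊍_ = combine false
_⋈_ = combine true

-- For n ≥ 3 the order 1 + (1 + (n ∸ 2)) equals n.
skillet : (n : ℕ) → Graph (1 + (1 + (n ∸ 2)))
skillet n = K 1 ⋈ (K 1 ⊍ K (n ∸ 2))

Cograph : ∀ {n} → Graph n → Set
Cograph G = ¬ Induced (path 4) G

-- Adjacency in the subgraph induced by S.
InducedAdj : ∀ {n} → Graph n → Subset n → Rel (Fin n) 0ℓ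
InducedAdj G S u v = u ∈ S × v ∈ S × T (adj G u v)

ConnectedOn : ∀ {n} → Graph n → Subset n → Set
ConnectedOn G S =
  Nonempty S × (∀ u v → u ∈ S → v ∈ S → Star (InducedAdj G S) u v)

Connected : ∀ {n} → Graph n → Set
Connected G = ConnectedOn G ⊤

-- Decidability of walks in a finite decidable relation, following
-- Floyd and Warshall: Via ws u v allows intermediate vertices from ws only.
module _ {n : ℕ} {R : Rel (Fin n) 0ℓ} (R? : Decidable R) where

  private
    Via : List (Fin n) → Rel (Fin n) 0ℓ
    Via []       u v = u ≡ v ⊎ R u v
    Via (w ∷ ws) u v = Via ws u v ⊎ (Via ws u w × Via ws w v)

    via? : ∀ ws → Decidable (Via ws)
    via? []       u v = (u Fin.≟ v) ⊎-dec R? u v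
    via? (w ∷ ws) u v = via? ws u v ⊎-dec (via? ws u w ×-dec via? ws w v)

    sound : ∀ ws {u v} → Via ws u v → Star R u v
    sound []       (inj₁ refl)    = ε
    sound []       (inj₂ r)       = r ◅ ε
    sound (_ ∷ ws) (inj₁ p)       = sound ws p
    sound (_ ∷ ws) (inj₂ (p , q)) = sound ws p ◅◅ sound ws q

    base : ∀ ws {u v} → u ≡ v ⊎ R u v → Via ws u v
    base []       p = p
    base (_ ∷ ws) p = inj₁ (base ws p)

    to-head : ∀ {w} ws {u} → Via (w ∷ ws) u w → Via ws u w
    to-head ws (inj₁ p)       = p
    to-head ws (inj₂ (p , _)) = p

    from-head : ∀ {w} ws {v} → Via (w ∷ ws) w v → Via ws w v
    from-head ws (inj₁ p)       = p
    from-head ws (inj₂ (_ , p)) = p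

    glue : ∀ ws {u w v} → w ∈ₗ ws → Via ws u w → Via ws w v → Via ws u v
    glue (_ ∷ ws) (here refl) p q = inj₂ (to-head ws p , from-head ws q)
    glue (_ ∷ ws) (there i) (inj₁ p)       (inj₁ q)       = inj₁ (glue ws i p q)
    glue (_ ∷ ws) (there i) (inj₁ p)       (inj₂ (q , r)) = inj₂ (glue ws i p q , r)
    glue (_ ∷ ws) (there i) (inj₂ (p , q)) (inj₁ r)       = inj₂ (p , glue ws i q r)
    glue (_ ∷ ws) (there i) (inj₂ (p , _)) (inj₂ (_ , q)) = inj₂ (p , q)

    complete : ∀ {u v} → Star R u v → Via (allFin n) u v
    complete ε        = base (allFin n) (inj₁ refl)
    complete (r ◅ rs) =
      glue (allFin n) (∈-allFin _) (base (allFin n) (inj₂ r)) (complete rs)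

  star? : Decidable (Star R)
  star? u v = map′ (sound (allFin n)) complete (via? (allFin n) u v)

connectedOn? : ∀ {n} (G : Graph n) (S : Subset n) → Dec (ConnectedOn G S)
connectedOn? G S =
  nonempty? S ×-dec
  Fin.all? λ u → Fin.all? λ v →
    (u ∈? S) →-dec ((v ∈? S) →-dec star? inducedAdj? u v)
  where
  inducedAdj? : Decidable (InducedAdj G S)
  inducedAdj? u v = (u ∈? S) ×-dec ((v ∈? S) ×-dec T? (adj G u v))

-- Each subset occurs exactly once.
allSubsets : (n : ℕ) → List (Subset n)
allSubsets 0       = [] ∷ []
allSubsets (suc n) =
  map (outside ∷_) (allSubsets n) ++ map (inside ∷_) (allSubsets n)

∈-allSubsets : ∀ {n} (S : Subset n) → S ∈ₗ allSubsets n
∈-allSubsets []            = here refl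
∈-allSubsets (outside ∷ S) = ∈-++⁺ˡ (∈-map⁺ (outside ∷_) (∈-allSubsets S))
∈-allSubsets {suc n} (inside ∷ S) =
  ∈-++⁺ʳ (map (outside ∷_) (allSubsets n)) (∈-map⁺ (inside ∷_) (∈-allSubsets S))

a : ∀ {n} → ℕ → Graph n → ℕ
a {n} k G =
  length (filter (λ S → (∣ S ∣ ≟ k) ×-dec connectedOn? G S) (allSubsets n))

-- Coefficients in ascending order of degree, starting with the constant term.
Polynomial : Set
Polynomial = List ℕ

eval : Polynomial → ℕ → ℕ
eval []       x = 0
eval (c ∷ cs) x = c + x * eval cs x

derivative : Polynomial → Polynomial
derivative []       = []
derivative (_ ∷ cs) = zipWith _*_ (applyUpTo suc (length cs)) cs

Φ : ∀ {n} → Graph n → Polynomial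
Φ {n} G = 0 ∷ applyUpTo (λ i → a (suc i) G) n

a₁>0 : ∀ {n} (G : Graph (suc n)) → 0 < a 1 G
a₁>0 {n} G = ∈-length (∈-filter⁺
  (λ S → (∣ S ∣ ≟ 1) ×-dec connectedOn? G S)
  (∈-allSubsets ⁅ zero ⁆)
  (∣⁅x⁆∣≡1 {suc n} zero , (zero , x∈⁅x⁆ zero) , walk))
  where
  walk : ∀ u v → u ∈ ⁅ zero ⁆ → v ∈ ⁅ zero ⁆ → Star (InducedAdj G ⁅ zero ⁆) u v
  walk u v u∈ v∈ with x∈⁅y⁆⇒x≡y zero u∈ | x∈⁅y⁆⇒x≡y zero v∈
  ... | refl | refl = ε

Φ[1]-nonZero : ∀ {n} .{{_ : NonZero n}} (G : Graph n) → NonZero (eval (Φ G) 1)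
Φ[1]-nonZero {suc n} G =
  >-nonZero (≤-trans (a₁>0 G) (≤-trans (m≤m+n (a 1 G) _) (m≤m+n _ 0)))

globalMean : ∀ {n} .{{_ : NonZero n}} → Graph n → ℚ
globalMean G = _/_ (+ eval (derivative (Φ G)) 1) (eval (Φ G) 1) {{Φ[1]-nonZero G}}

{-# OPTIONS --safe #-}

-- Write #d for the number of nonempty disconnected vertex sets of G and w for
-- the sum of their sizes.  Pairing S with its complement gives
--   2 Φ′(1) − n Φ(1) = n + n #d − 2 w   and   Φ(1) + #d = 2ⁿ − 1,
-- so it suffices that this excess is at least 3, or that it is at least 2 while
-- Φ(1) < 3·2ⁿ⁻²; the skillet has excess 2 and Φ(1) = 3·2ⁿ⁻².
-- A cograph is described by a cotree, and #d and w are easily followed through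
-- joins (both are additive, as a set meeting both sides is connected) and through
-- disjoint unions (where every set meeting both sides is disconnected).  Induction
-- on the cotree yields 2 w ≤ (n + 2) #d, with equality only for complete graphs
-- and for 2K₁.  A connected cograph of order n ≥ 3 is a join; applying the
-- inequality to its two sides, or to the parts of A when G = K₁ ⋈ A, gives the
-- required bound on the excess.
module Submission where

open import Defs
open import Data.Bool using (Bool; true; false; not; T; if_then_else_)
import Data.Bool.Properties as Bool
open import Data.Fin using (Fin; zero; suc; splitAt; fromℕ<; _↑ˡ_; _↑ʳ_)
open import Data.Fin.Permutation using (↔⇒≡)
import Data.Fin.Properties as Fin
open import Data.Fin.Subset using (Subset; inside; outside; ∣_∣; ⊤; ⊥; Nonempty; _∈_)
open import Data.Fin.Subset.Properties using (∉⊥; ∈⊤; nonempty?; ∣⊥∣≡0; ∣p∣≤n)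
import Data.Integer as ℤ
import Data.Integer.Properties as ℤ
open import Data.List
  using (List; []; _∷_; _++_; map; filter; length; applyUpTo; zipWith; allFin)
open import Data.List.Membership.Propositional using () renaming (_∈_ to _∈ₗ_)
open import Data.List.Membership.Propositional.Properties using (∈-allFin; ∈-map⁺; ∈-map⁻)
open import Data.List.Membership.Propositional.Properties.WithK using (unique∧set⇒bag)
open import Data.List.Properties using (map-++; map-∘; map-cong-local; map-cong; length-applyUpTo)
open import Data.List.Relation.Binary.BagAndSetEquality using (∼bag⇒↭)
open import Data.List.Relation.Binary.Permutation.Propositional using (_↭_)
open import Data.List.Relation.Binary.Permutation.Propositional.Properties using (map⁺)
open import Data.List.Relation.Unary.All as All using (All; []; _∷_)
import Data.List.Relation.Unary.All.Properties as All
open import Data.List.Relation.Unary.AllPairs using ([]; _∷_)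
open import Data.List.Relation.Unary.Any using (here; there)
open import Data.List.Relation.Unary.Unique.Propositional using (Unique)
import Data.List.Relation.Unary.Unique.Propositional.Properties as Unique
open import Data.Nat
  using (ℕ; zero; suc; _≤_; _<_; _*_; _∸_; _^_; _≟_; NonZero; z≤n; s≤s; z<s; >-nonZero)
open import Data.Nat.ListAction using (sum)
open import Data.Nat.ListAction.Properties using (sum-++; sum-↭)
open import Data.Nat.Properties hiding (_≟_)
open import Algebra.Properties.CommutativeMonoid.Sum +-0-commutativeMonoid
  using (sum-permute; sum-cong-≗) renaming (sum to sumᶠ)
open import Data.Nat.Tactic.RingSolver using (solve-∀)
open import Data.Product using (_×_; _,_; proj₁; proj₂; ∃; ∃-syntax)
open import Data.Rational as ℚ using (ℚ; _/_)
import Data.Rational.Properties as ℚ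
open import Data.Rational.Unnormalised as ℚᵘ using (ℚᵘ; mkℚᵘ; *≤*; *≡*)
import Data.Rational.Unnormalised.Properties as ℚᵘ
open import Data.Sum using (_⊎_; inj₁; inj₂; [_,_]′; swap)
open import Data.Unit using (tt) renaming (⊤ to Unit)
open import Data.Vec using ([]; _∷_; lookup; tabulate; here; there) renaming (_++_ to _++ᵛ_)
open import Data.Vec.Properties using (lookup∘tabulate; tabulate∘lookup; tabulate-cong;
  []=⇒lookup; lookup⇒[]=; lookup-++ˡ; lookup-++ʳ; ∷-injectiveʳ)
open import Function using (_∘_; const; case_of_)
open import Function.Bundles using (_⇔_; _↔_; mk⇔; Equivalence; Inverse; Injection; mk↔ₛ′)
open import Function.Definitions using (Injective)
open import Function.Properties.Inverse using (↔⇒↣; ↔-sym)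
open import Relation.Binary.Construct.Closure.ReflexiveTransitive using (Star; ε; _◅_)
open import Relation.Binary.PropositionalEquality
open import Relation.Nullary using (¬_; Dec; yes; no; does; contradiction)
open import Relation.Nullary.Decidable
  using (from-yes; does-⇔; _×-dec_; _⊎-dec_; _→-dec_; ¬?; dec-true; dec-false)

-- Multiplied out, the bound says that the excess times 3·2ⁿ⁻² is at least 2 Φ(1). Since Φ(1) <
-- 4·2ⁿ⁻² always, an excess of 3 is enough because 3·3 > 2·4, while with an excess of 2 everything
-- hangs on whether Φ(1) reaches 3·2ⁿ⁻². The coefficient n + 2 of the induction is dictated by 2K₁,
-- where #d = 1 and w = 2. In a join whose other side has order at least 2, the growth of the order
-- absorbs the summand 2. In a cone K₁ ⋈ A the order grows by 1 only; this is why cones call for a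
-- finer look at the parts of A, and why the graphs in question that have excess 2 are all cones:
-- besides the skillets, for instance the claw and K₁ ⋈ 2K₂. The cotree is grown by inserting one
-- vertex at a time, and the absence of induced 4-vertex paths enters there alone.

private variable
  m n : ℕ
  A B : Set

module _ where
  open import Data.Nat using (_+_)

  -- Cotrees

  ≅-intro : {G : Graph m} {H : Graph n} (f : Fin m → Fin n) → Injective _≡_ _≡_ f →
            (∀ y → ∃[ x ] f x ≡ y) → (∀ u v → adj H (f u) (f v) ≡ adj G u v) → G ≅ H
  ≅-intro f inj surj pres = record
    { bijection = mk↔ₛ′ f (proj₁ ∘ surj) (proj₂ ∘ surj) (λ x → inj (proj₂ (surj (f x))))
    ; preserves = pres
    }

  to-injective : (π : Fin m ↔ Fin n) → Injective _≡_ _≡_ (Inverse.to π)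
  to-injective π = Injection.injective (↔⇒↣ π)

  ≅-sym : {G : Graph m} {H : Graph n} → G ≅ H → H ≅ G
  ≅-sym {G = G} {H} G≅H = ≅-intro from
    (to-injective (↔-sym (_≅_.bijection G≅H)))
    (λ x → to x , strictlyInverseʳ x)
    (λ u v → trans (sym (_≅_.preserves G≅H _ _))
                   (cong₂ (adj H) (strictlyInverseˡ u) (strictlyInverseˡ v)))
    where open Inverse (_≅_.bijection G≅H)

  ≅-trans : ∀ {k} {F : Graph k} {G : Graph m} {H : Graph n} → F ≅ G → G ≅ H → F ≅ H
  ≅-trans F≅G G≅H = ≅-intro (g.to ∘ f.to)
    (λ eq → to-injective (_≅_.bijection F≅G) (to-injective (_≅_.bijection G≅H) eq))
    (λ z → f.from (g.from z) ,
           trans (cong g.to (f.strictlyInverseˡ (g.from z))) (g.strictlyInverseˡ z))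
    (λ u v → trans (_≅_.preserves G≅H _ _) (_≅_.preserves F≅G u v))
    where
    module f = Inverse (_≅_.bijection F≅G)
    module g = Inverse (_≅_.bijection G≅H)

  infix 4 _≗ᴳ_
  _≗ᴳ_ : Graph n → Graph n → Set
  G ≗ᴳ H = ∀ u v → adj G u v ≡ adj H u v

  ≗ᴳ⇒≅ : {G H : Graph n} → G ≗ᴳ H → G ≅ H
  ≗ᴳ⇒≅ eq = ≅-intro (λ x → x) (λ e → e) (λ y → y , refl) (λ u v → sym (eq u v))

  Complete : Graph n → Set
  Complete G = ∀ u v → u ≢ v → adj G u v ≡ true

  K-complete : ∀ n → Complete (K n)
  K-complete n u v u≢v with u Fin.≟ v
  ... | yes u≡v = contradiction u≡v u≢v
  ... | no _    = refl

  complete⇒≗K : {G : Graph n} → Complete G → G ≗ᴳ K n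
  complete⇒≗K {n = n} {G = G} complete u v with u Fin.≟ v
  ... | yes refl = adj-irrefl G u
  ... | no u≢v   = complete u v u≢v

  -- A match on this view rewrites the vertex itself to an image under `↑ˡ` or `↑ʳ`, which a match
  -- on `splitAt` does not.
  data Side (m n : ℕ) : Fin (m + n) → Set where
    left  : (u : Fin m) → Side m n (u ↑ˡ n)
    right : (v : Fin n) → Side m n (m ↑ʳ v)

  side : ∀ m n (i : Fin (m + n)) → Side m n i
  side m n i with splitAt m i in eq
  ... | inj₁ u = subst (Side m n) (Fin.splitAt⁻¹-↑ˡ eq) (left u)
  ... | inj₂ v = subst (Side m n) (Fin.splitAt⁻¹-↑ʳ eq) (right v)

  module _ (b : Bool) (G : Graph m) (H : Graph n) where
    adj-ˡˡ : ∀ u v → adj (combine b G H) (u ↑ˡ n) (v ↑ˡ n) ≡ adj G u v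
    adj-ˡˡ u v rewrite Fin.splitAt-↑ˡ m u n | Fin.splitAt-↑ˡ m v n = refl

    adj-ˡʳ : ∀ u v → adj (combine b G H) (u ↑ˡ n) (m ↑ʳ v) ≡ b
    adj-ˡʳ u v rewrite Fin.splitAt-↑ˡ m u n | Fin.splitAt-↑ʳ m n v = refl

    adj-ʳˡ : ∀ u v → adj (combine b G H) (m ↑ʳ u) (v ↑ˡ n) ≡ b
    adj-ʳˡ u v rewrite Fin.splitAt-↑ʳ m n u | Fin.splitAt-↑ˡ m v n = refl

    adj-ʳʳ : ∀ u v → adj (combine b G H) (m ↑ʳ u) (m ↑ʳ v) ≡ adj H u v
    adj-ʳʳ u v rewrite Fin.splitAt-↑ʳ m n u | Fin.splitAt-↑ʳ m n v = refl

  combine-congʳ : ∀ b (G : Graph m) {H H′ : Graph n} → H ≗ᴳ H′ → combine b G H ≗ᴳ combine b G H′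
  combine-congʳ {m} {n} b G H≗H′ u v with splitAt m u | splitAt m v
  ... | inj₁ _ | inj₁ _ = refl
  ... | inj₁ _ | inj₂ _ = refl
  ... | inj₂ _ | inj₁ _ = refl
  ... | inj₂ u | inj₂ v = H≗H′ u v

  ⋈-complete : (G : Graph m) (H : Graph n) → Complete G → Complete H → Complete (G ⋈ H)
  ⋈-complete {m} {n} G H cG cH x y x≢y with side m n x | side m n y
  ... | left u  | left v  = trans (adj-ˡˡ true G H u v) (cG u v (x≢y ∘ cong (_↑ˡ n)))
  ... | left u  | right v = adj-ˡʳ true G H u v
  ... | right u | left v  = adj-ʳˡ true G H u v
  ... | right u | right v = trans (adj-ʳʳ true G H u v) (cH u v (x≢y ∘ cong (m ↑ʳ_)))

  -- Labels place a tree inside a given graph, while `⟦_⟧` sees the shape alone. A node marked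
  -- `true` is a join, one marked `false` a disjoint union. Nodes are binary and marks may repeat
  -- along a branch, so insertion can create a node of either type anywhere.
  data Cotree (V : Set) : Set where
    leaf : V → Cotree V
    node : Bool → Cotree V → Cotree V → Cotree V

  size : ∀ {V} → Cotree V → ℕ
  size (leaf _)     = 1
  size (node _ l r) = size l + size r

  ⟦_⟧ : ∀ {V} (t : Cotree V) → Graph (size t)
  ⟦ leaf _ ⟧     = K 1
  ⟦ node b l r ⟧ = combine b ⟦ l ⟧ ⟦ r ⟧

  infix 4 _∈ᵗ_
  _∈ᵗ_ : ∀ {V} → V → Cotree V → Set
  x ∈ᵗ leaf y     = x ≡ y
  x ∈ᵗ node _ l r = x ∈ᵗ l ⊎ x ∈ᵗ r

  _∈ᵗ?_ : ∀ (x : Fin n) t → Dec (x ∈ᵗ t)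
  x ∈ᵗ? leaf y     = x Fin.≟ y
  x ∈ᵗ? node _ l r = (x ∈ᵗ? l) ⊎-dec (x ∈ᵗ? r)

  label : ∀ {V} (t : Cotree V) → Fin (size t) → V
  label (leaf x) _ = x
  label (node _ l r) i with splitAt (size l) i
  ... | inj₁ j = label l j
  ... | inj₂ j = label r j

  label-↑ˡ : ∀ {V} b (l r : Cotree V) i → label (node b l r) (i ↑ˡ size r) ≡ label l i
  label-↑ˡ b l r i rewrite Fin.splitAt-↑ˡ (size l) i (size r) = refl

  label-↑ʳ : ∀ {V} b (l r : Cotree V) i → label (node b l r) (size l ↑ʳ i) ≡ label r i
  label-↑ʳ b l r i rewrite Fin.splitAt-↑ʳ (size l) (size r) i = refl

  label-∈ : ∀ {V} (t : Cotree V) i → label t i ∈ᵗ t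
  label-∈ (leaf _) i = refl
  label-∈ (node _ l r) i with splitAt (size l) i
  ... | inj₁ j = inj₁ (label-∈ l j)
  ... | inj₂ j = inj₂ (label-∈ r j)

  label-surjective : ∀ {V} (t : Cotree V) {x} → x ∈ᵗ t → ∃[ i ] label t i ≡ x
  label-surjective (leaf _) refl = zero , refl
  label-surjective (node b l r) (inj₁ x∈l) with i , refl ← label-surjective l x∈l =
    i ↑ˡ size r , label-↑ˡ b l r i
  label-surjective (node b l r) (inj₂ x∈r) with i , refl ← label-surjective r x∈r =
    size l ↑ʳ i , label-↑ʳ b l r i

  path₄-induced : (G : Graph n) → ∀ p q r s →
    adj G p q ≡ true → adj G q r ≡ true → adj G r s ≡ true →
    adj G p r ≡ false → adj G p s ≡ false → adj G q s ≡ false → Induced (path 4) G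
  path₄-induced {n} G p q r s pq qr rs pr ps qs = record
    { embed = f ; injective = λ {i} {j} → inj i j ; preserves = pres }
    where
    f : Fin 4 → Fin n
    f zero = p
    f (suc zero) = q
    f (suc (suc zero)) = r
    f (suc (suc (suc zero))) = s

    pres : ∀ u v → adj G (f u) (f v) ≡ adj (path 4) u v
    pres zero zero = adj-irrefl G p
    pres zero (suc zero) = pq
    pres zero (suc (suc zero)) = pr
    pres zero (suc (suc (suc zero))) = ps
    pres (suc zero) zero = trans (adj-sym G q p) pq
    pres (suc zero) (suc zero) = adj-irrefl G q
    pres (suc zero) (suc (suc zero)) = qr
    pres (suc zero) (suc (suc (suc zero))) = qs
    pres (suc (suc zero)) zero = trans (adj-sym G r p) pr
    pres (suc (suc zero)) (suc zero) = trans (adj-sym G r q) qr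
    pres (suc (suc zero)) (suc (suc zero)) = adj-irrefl G r
    pres (suc (suc zero)) (suc (suc (suc zero))) = rs
    pres (suc (suc (suc zero))) zero = trans (adj-sym G s p) ps
    pres (suc (suc (suc zero))) (suc zero) = trans (adj-sym G s q) qs
    pres (suc (suc (suc zero))) (suc (suc zero)) = trans (adj-sym G s r) rs
    pres (suc (suc (suc zero))) (suc (suc (suc zero))) = adj-irrefl G s

    -- The four vertices of the path have pairwise different neighbourhoods, so injectivity of `f`
    -- follows from preservation of adjacency; p, q, r and s are not assumed distinct.
    twin-free : ∀ i j → (∀ k → adj (path 4) i k ≡ adj (path 4) j k) → i ≡ j
    twin-free = from-yes (Fin.all? λ i → Fin.all? λ j →
      (Fin.all? λ k → adj (path 4) i k Bool.≟ adj (path 4) j k) →-dec (i Fin.≟ j))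

    inj : ∀ i j → f i ≡ f j → i ≡ j
    inj i j eq = twin-free i j λ k →
      trans (sym (pres i k)) (trans (cong (λ x → adj G x (f k)) eq) (pres j k))

  module _ {n : ℕ} (G : Graph n) where

    -- The labels may cover only some vertices of `G`, as they do while the tree grows. The
    -- condition `u ≢ v` across every node makes all labels distinct.
    Realises : Cotree (Fin n) → Set
    Realises (leaf _)     = Unit
    Realises (node b l r) = Realises l × Realises r ×
      (∀ {u v} → u ∈ᵗ l → v ∈ᵗ r → u ≢ v × adj G u v ≡ b)

    label-injective : ∀ t → Realises t → Injective _≡_ _≡_ (label t)
    label-injective (leaf _) _ {zero} {zero} _ = refl
    label-injective (node b l r) (vl , vr , cross) {i} {j} eq
      with side (size l) (size r) i | side (size l) (size r) j
    ... | left u  | left v  = cong (_↑ˡ size r) (label-injective l vl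
            (trans (sym (label-↑ˡ b l r u)) (trans eq (label-↑ˡ b l r v))))
    ... | right u | right v = cong (size l ↑ʳ_) (label-injective r vr
            (trans (sym (label-↑ʳ b l r u)) (trans eq (label-↑ʳ b l r v))))
    ... | left u  | right v = contradiction
            (trans (sym (label-↑ˡ b l r u)) (trans eq (label-↑ʳ b l r v)))
            (proj₁ (cross (label-∈ l u) (label-∈ r v)))
    ... | right u | left v  = contradiction
            (trans (sym (label-↑ˡ b l r v)) (trans (sym eq) (label-↑ʳ b l r u)))
            (proj₁ (cross (label-∈ l v) (label-∈ r u)))

    label-adj : ∀ t → Realises t → ∀ i j → adj G (label t i) (label t j) ≡ adj ⟦ t ⟧ i j
    label-adj (leaf x) _ zero zero = adj-irrefl G x
    label-adj (node b l r) (vl , vr , cross) i j with splitAt (size l) i | splitAt (size l) j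
    ... | inj₁ u | inj₁ v = label-adj l vl u v
    ... | inj₁ u | inj₂ v = proj₂ (cross (label-∈ l u) (label-∈ r v))
    ... | inj₂ u | inj₁ v = trans (adj-sym G _ _) (proj₂ (cross (label-∈ l v) (label-∈ r u)))
    ... | inj₂ u | inj₂ v = label-adj r vr u v

    ⟦⟧≅ : ∀ t → Realises t → (∀ v → v ∈ᵗ t) → ⟦ t ⟧ ≅ G
    ⟦⟧≅ t v all = ≅-intro (label t) (label-injective t v) (λ y → label-surjective t (all y))
      (label-adj t v)

    search : (p : Fin n → Bool) (b : Bool) (t : Cotree (Fin n)) →
      (∃[ v ] v ∈ᵗ t × p v ≡ not b) ⊎ (∀ {v} → v ∈ᵗ t → p v ≡ b)
    search p b (leaf x) with p x Bool.≟ b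
    ... | yes px = inj₂ λ { refl → px }
    ... | no ¬px = inj₁ (x , refl , Bool.¬-not ¬px)
    search p b (node _ l r) with search p b l | search p b r
    ... | inj₁ (v , v∈l , pv) | _ = inj₁ (v , inj₁ v∈l , pv)
    ... | inj₂ _ | inj₁ (v , v∈r , pv) = inj₁ (v , inj₂ v∈r , pv)
    ... | inj₂ allˡ | inj₂ allʳ = inj₂ λ { (inj₁ v∈l) → allˡ v∈l ; (inj₂ v∈r) → allʳ v∈r }

    Restriction : (p : Fin n → Bool) → Bool → Cotree (Fin n) → Cotree (Fin n) → Set
    Restriction p b t s = Realises s ×
      (∀ {v} → v ∈ᵗ s → v ∈ᵗ t × p v ≡ b) × (∀ {v} → v ∈ᵗ t → p v ≡ b → v ∈ᵗ s)

    -- There is no empty cotree, whence the first alternative; a node with one side emptied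
    -- collapses to its other side.
    restrict : ∀ p b t → Realises t →
      (∀ {v} → v ∈ᵗ t → p v ≢ b) ⊎ ∃ (Restriction p b t)
    restrict p b (leaf x) _ with p x Bool.≟ b
    ... | yes px = inj₂ (leaf x , tt , (λ { refl → refl , px }) , λ v∈ _ → v∈)
    ... | no ¬px = inj₁ λ { refl → ¬px }
    restrict p b (node c l r) (vl , vr , cross) with restrict p b l vl | restrict p b r vr
    ... | inj₁ noˡ | inj₁ noʳ = inj₁ λ { (inj₁ v∈l) → noˡ v∈l ; (inj₂ v∈r) → noʳ v∈r }
    ... | inj₁ noˡ | inj₂ (s , vs , s⊆ , ⊆s) = inj₂ (s , vs ,
          (λ v∈s → inj₂ (proj₁ (s⊆ v∈s)) , proj₂ (s⊆ v∈s)) ,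
          λ { (inj₁ v∈l) pv → contradiction pv (noˡ v∈l) ; (inj₂ v∈r) pv → ⊆s v∈r pv })
    ... | inj₂ (s , vs , s⊆ , ⊆s) | inj₁ noʳ = inj₂ (s , vs ,
          (λ v∈s → inj₁ (proj₁ (s⊆ v∈s)) , proj₂ (s⊆ v∈s)) ,
          λ { (inj₁ v∈l) pv → ⊆s v∈l pv ; (inj₂ v∈r) pv → contradiction pv (noʳ v∈r) })
    ... | inj₂ (s , vs , s⊆ , ⊆s) | inj₂ (s′ , vs′ , s′⊆ , ⊆s′) = inj₂ (node c s s′ ,
          (vs , vs′ , λ u∈ v∈ → cross (proj₁ (s⊆ u∈)) (proj₁ (s′⊆ v∈))) ,
          (λ { (inj₁ v∈) → inj₁ (proj₁ (s⊆ v∈)) , proj₂ (s⊆ v∈)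
             ; (inj₂ v∈) → inj₂ (proj₁ (s′⊆ v∈)) , proj₂ (s′⊆ v∈) }) ,
          λ { (inj₁ v∈) pv → inj₁ (⊆s v∈ pv) ; (inj₂ v∈) pv → inj₂ (⊆s′ v∈ pv) })

    module _ (cograph : Cograph G) where

      -- The path is w-u-x-v if b is false; if b is true, that is its complement,
      -- and the path is x-w-v-u.
      no-path₄ : ∀ b w u x v →
        adj G w u ≡ not b → adj G u x ≡ not b → adj G x v ≡ not b →
        adj G w x ≡ b → adj G w v ≡ b → adj G u v ≢ b
      no-path₄ false w u x v wu ux xv wx wv uv =
        cograph (path₄-induced G w u x v wu ux xv wx wv uv)
      no-path₄ true w u x v wu ux xv wx wv uv =
        cograph (path₄-induced G x w v u (trans (adj-sym G x w) wx) wv (trans (adj-sym G v u) uv)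
          xv (trans (adj-sym G x u) ux) wu)

      -- Vertices u and w on the same side of a node cannot be told apart by x,
      -- since x also separates some v on the opposite side from the node's type b.
      separated : ∀ {b l r x v₁ v₂} →
        (∀ {u v} → u ∈ᵗ l → v ∈ᵗ r → u ≢ v × adj G u v ≡ b) →
        v₁ ∈ᵗ l → adj G x v₁ ≡ not b → v₂ ∈ᵗ r → adj G x v₂ ≡ not b →
        ∀ {u w} → u ∈ᵗ node b l r → adj G x u ≡ not b → w ∈ᵗ node b l r → adj G x w ≡ b →
        adj G u w ≡ b
      separated {b} {x = x} {v₁} {v₂} cross v₁∈ xv₁ v₂∈ xv₂ {u} {w} u∈ xu w∈ xw = go u∈ w∈
        where
        by : ∀ v → adj G x v ≡ not b → adj G w v ≡ b → adj G u v ≡ b → adj G u w ≡ b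
        by v xv wv uv with adj G u w Bool.≟ b
        ... | yes uw = uw
        ... | no ¬uw = contradiction uv
          (no-path₄ b w u x v (trans (adj-sym G w u) (Bool.¬-not ¬uw)) (trans (adj-sym G u x) xu) xv
            (trans (adj-sym G w x) xw) wv)
        go : u ∈ᵗ node b _ _ → w ∈ᵗ node b _ _ → adj G u w ≡ b
        go (inj₁ u∈l) (inj₂ w∈r) = proj₂ (cross u∈l w∈r)
        go (inj₂ u∈r) (inj₁ w∈l) = trans (adj-sym G u w) (proj₂ (cross w∈l u∈r))
        go (inj₁ u∈l) (inj₁ w∈l) = by v₂ xv₂ (proj₂ (cross w∈l v₂∈)) (proj₂ (cross u∈l v₂∈))
        go (inj₂ u∈r) (inj₂ w∈r) = by v₁ xv₁ (trans (adj-sym G w v₁) (proj₂ (cross v₁∈ w∈r)))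
          (trans (adj-sym G u v₁) (proj₂ (cross v₁∈ u∈r)))

      Insertion : Fin n → Cotree (Fin n) → Cotree (Fin n) → Set
      Insertion x t s = Realises s × x ∈ᵗ s × (∀ {v} → v ∈ᵗ t → v ∈ᵗ s) ×
        (∀ {v} → v ∈ᵗ s → v ≡ x ⊎ v ∈ᵗ t)

      -- If x sees a whole side of the node with the node's type b, it descends into the other side.
      -- Otherwise each side has a vertex that x sees with the opposite type: either x sees all of
      -- `t` so and becomes its sibling under a new root, or `t` is regrouped by adjacency to x.
      insert : ∀ x t → Realises t → ¬ x ∈ᵗ t → ∃ (Insertion x t)
      insert x (leaf y) _ x∉ =
        node (adj G x y) (leaf x) (leaf y) , (tt , tt , λ { refl refl → x∉ , refl }) , inj₁ refl ,
        inj₂ , λ v∈ → v∈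
      insert x t@(node b l r) vt@(vl , vr , cross) x∉
        with search (adj G x) b l | search (adj G x) b r
      ... | inj₂ allˡ | _ with s , vs , x∈s , ⊆s , s⊆ ← insert x r vr (x∉ ∘ inj₂) =
        node b l s ,
        (vl , vs , λ u∈ v∈ → case s⊆ v∈ of λ
          { (inj₁ refl) → (λ { refl → x∉ (inj₁ u∈) }) , trans (adj-sym G _ x) (allˡ u∈)
          ; (inj₂ v∈r)  → cross u∈ v∈r }) ,
        inj₂ x∈s ,
        (λ { (inj₁ v∈) → inj₁ v∈ ; (inj₂ v∈) → inj₂ (⊆s v∈) }) ,
        λ { (inj₁ v∈) → inj₂ (inj₁ v∈)
          ; (inj₂ v∈) → case s⊆ v∈ of λ { (inj₁ eq) → inj₁ eq ; (inj₂ v∈r) → inj₂ (inj₂ v∈r) } }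
      ... | inj₁ _ | inj₂ allʳ with s , vs , x∈s , ⊆s , s⊆ ← insert x l vl (x∉ ∘ inj₁) =
        node b s r ,
        (vs , vr , λ u∈ v∈ → case s⊆ u∈ of λ
          { (inj₁ refl) → (λ { refl → x∉ (inj₂ v∈) }) , allʳ v∈
          ; (inj₂ u∈l)  → cross u∈l v∈ }) ,
        inj₁ x∈s ,
        (λ { (inj₁ v∈) → inj₁ (⊆s v∈) ; (inj₂ v∈) → inj₂ v∈ }) ,
        λ { (inj₂ v∈) → inj₂ (inj₂ v∈)
          ; (inj₁ v∈) → case s⊆ v∈ of λ { (inj₁ eq) → inj₁ eq ; (inj₂ v∈l) → inj₂ (inj₁ v∈l) } }
      ... | inj₁ (v₁ , v₁∈ , xv₁) | inj₁ (v₂ , v₂∈ , xv₂)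
        with restrict (adj G x) (not b) t vt | restrict (adj G x) b t vt
      ... | inj₁ none | _ = contradiction xv₁ (none (inj₁ v₁∈))
      ... | inj₂ _ | inj₁ none =
        node (not b) (leaf x) t ,
        (tt , vt , λ { refl v∈ → (λ { refl → x∉ v∈ }) , Bool.¬-not (none v∈) }) ,
        inj₁ refl , inj₂ , λ v∈ → v∈
      -- By `separated` the two adjacency classes of x cross with type b throughout. They can
      -- therefore be the sides of a node of type b, with x placed beside the class that it sees
      -- with type `not b`.
      ... | inj₂ (s , vs , s⊆ , ⊆s) | inj₂ (s′ , vs′ , s′⊆ , ⊆s′) =
        node b (node (not b) (leaf x) s) s′ ,
        ((tt , vs , λ { refl v∈ → (λ { refl → x∉ (proj₁ (s⊆ v∈)) }) , proj₂ (s⊆ v∈) }) , vs′ ,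
          λ { (inj₁ refl) v∈ → (λ { refl → x∉ (proj₁ (s′⊆ v∈)) }) , proj₂ (s′⊆ v∈)
            ; (inj₂ u∈) v∈ →
                (λ { refl → Bool.not-¬ refl (trans (sym (proj₂ (s′⊆ v∈))) (proj₂ (s⊆ u∈))) }) ,
                separated cross v₁∈ xv₁ v₂∈ xv₂
                  (proj₁ (s⊆ u∈)) (proj₂ (s⊆ u∈)) (proj₁ (s′⊆ v∈)) (proj₂ (s′⊆ v∈)) }) ,
        inj₁ (inj₁ refl) ,
        (λ {v} v∈ → case adj G x v Bool.≟ b of λ
          { (yes xv) → inj₂ (⊆s′ v∈ xv)
          ; (no ¬xv) → inj₁ (inj₂ (⊆s v∈ (Bool.¬-not ¬xv))) }) ,
        λ { (inj₁ (inj₁ eq)) → inj₁ eq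
          ; (inj₁ (inj₂ v∈)) → inj₂ (proj₁ (s⊆ v∈))
          ; (inj₂ v∈)        → inj₂ (proj₁ (s′⊆ v∈)) }

      -- A vertex already in the tree is skipped, so the list may contain repetitions; this allows
      -- `zero` in front of `allFin` to make the list visibly nonempty.
      cotree-on : ∀ x xs → ∃[ t ] Realises t × (∀ {v} → v ∈ₗ x ∷ xs → v ∈ᵗ t)
      cotree-on x [] = leaf x , tt , λ { (here eq) → eq }
      cotree-on x (y ∷ ys) with t , vt , ⊆t ← cotree-on y ys with x ∈ᵗ? t
      ... | yes x∈ = t , vt , λ { (here refl) → x∈ ; (there v∈) → ⊆t v∈ }
      ... | no x∉ = let s , vs , x∈ , ⊆s , _ = insert x t vt x∉ in
        s , vs , λ { (here refl) → x∈ ; (there v∈) → ⊆s (⊆t v∈) }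

  cograph⇒cotree : (G : Graph (suc n)) → Cograph G → ∃[ t ] Realises G t × (∀ v → v ∈ᵗ t)
  cograph⇒cotree G cograph with t , vt , ⊆t ← cotree-on G cograph zero (allFin _) =
    t , vt , λ v → ⊆t (there (∈-allFin v))

  -- Counting disconnected sets

  ∑ : List A → (A → ℕ) → ℕ
  ∑ xs f = sum (map f xs)

  syntax ∑ xs (λ x → e) = ∑[ x ← xs ] e

  ∑-cong : (xs : List A) {f g : A → ℕ} → (∀ x → f x ≡ g x) → ∑ xs f ≡ ∑ xs g
  ∑-cong xs eq = cong sum (map-cong eq xs)

  ∑-cong-All : {xs : List A} {f g : A → ℕ} → All (λ x → f x ≡ g x) xs → ∑ xs f ≡ ∑ xs g
  ∑-cong-All eqs = cong sum (map-cong-local eqs)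

  ∑-++ : (xs ys : List A) (f : A → ℕ) → ∑ (xs ++ ys) f ≡ ∑ xs f + ∑ ys f
  ∑-++ xs ys f = trans (cong sum (map-++ f xs ys)) (sum-++ (map f xs) (map f ys))

  ∑-map : (g : A → B) (xs : List A) (f : B → ℕ) → ∑ (map g xs) f ≡ ∑ xs (f ∘ g)
  ∑-map g xs f = cong sum (sym (map-∘ xs))

  +-interchange : ∀ a b c d → a + b + (c + d) ≡ a + c + (b + d)
  +-interchange = solve-∀

  ∑-+ : (xs : List A) (f g : A → ℕ) → ∑[ x ← xs ] (f x + g x) ≡ ∑ xs f + ∑ xs g
  ∑-+ []       f g = refl
  ∑-+ (x ∷ xs) f g = trans (cong (f x + g x +_) (∑-+ xs f g)) (+-interchange (f x) (g x) _ _)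

  ∑-*ˡ : (xs : List A) (c : ℕ) (f : A → ℕ) → ∑[ x ← xs ] (c * f x) ≡ c * ∑ xs f
  ∑-*ˡ []       c f = sym (*-zeroʳ c)
  ∑-*ˡ (x ∷ xs) c f = trans (cong (c * f x +_) (∑-*ˡ xs c f)) (sym (*-distribˡ-+ c (f x) _))

  ∑-*ʳ : (xs : List A) (c : ℕ) (f : A → ℕ) → ∑[ x ← xs ] (f x * c) ≡ ∑ xs f * c
  ∑-*ʳ xs c f = trans (∑-cong xs λ x → *-comm (f x) c) (trans (∑-*ˡ xs c f) (*-comm c _))

  ∑-0 : (xs : List A) → ∑[ x ← xs ] 0 ≡ 0
  ∑-0 []       = refl
  ∑-0 (_ ∷ xs) = ∑-0 xs

  -- The recursion copies that of `allSubsets`, so the empty set is literally the head of that list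
  -- and can be split off a sum without reordering.
  nonempties : (n : ℕ) → List (Subset n)
  nonempties 0       = []
  nonempties (suc n) = map (outside ∷_) (nonempties n) ++ map (inside ∷_) (allSubsets n)

  allSubsets≡ : ∀ n → allSubsets n ≡ ⊥ ∷ nonempties n
  allSubsets≡ 0       = refl
  allSubsets≡ (suc n) =
    cong (λ xs → map (outside ∷_) xs ++ map (inside ∷_) (allSubsets n)) (allSubsets≡ n)

  nonempties-Nonempty : ∀ n → All Nonempty (nonempties n)
  nonempties-Nonempty 0       = []
  nonempties-Nonempty (suc n) = All.++⁺
    (All.map⁺ (All.map (λ (i , i∈) → suc i , there i∈) (nonempties-Nonempty n)))
    (All.map⁺ (All.universal (λ _ → zero , here) (allSubsets n)))

  ∑-allSubsets : ∀ n (f : Subset n → ℕ) → ∑ (allSubsets n) f ≡ f ⊥ + ∑ (nonempties n) f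
  ∑-allSubsets n f = cong (λ xs → ∑ xs f) (allSubsets≡ n)

  ∑-allSubsets-⊥≡0 : ∀ n (f : Subset n → ℕ) → f ⊥ ≡ 0 → ∑ (allSubsets n) f ≡ ∑ (nonempties n) f
  ∑-allSubsets-⊥≡0 n f f⊥≡0 = trans (∑-allSubsets n f) (cong (_+ ∑ (nonempties n) f) f⊥≡0)

  ∑-allSubsets-suc : ∀ n (f : Subset (suc n) → ℕ) →
    ∑ (allSubsets (suc n)) f ≡ ∑ (allSubsets n) (f ∘ (outside ∷_)) + ∑ (allSubsets n) (f ∘ (inside ∷_))
  ∑-allSubsets-suc n f = trans (∑-++ (map (outside ∷_) (allSubsets n)) _ f)
    (cong₂ _+_ (∑-map (outside ∷_) (allSubsets n) f) (∑-map (inside ∷_) (allSubsets n) f))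

  ∑-allSubsets-++ : ∀ m n (f : Subset (m + n) → ℕ) →
    ∑ (allSubsets (m + n)) f ≡ ∑[ S ← allSubsets m ] ∑[ U ← allSubsets n ] f (S ++ᵛ U)
  ∑-allSubsets-++ 0       n f = sym (+-identityʳ _)
  ∑-allSubsets-++ (suc m) n f = trans (∑-allSubsets-suc (m + n) f) (trans
    (cong₂ _+_ (∑-allSubsets-++ m n (f ∘ (outside ∷_))) (∑-allSubsets-++ m n (f ∘ (inside ∷_))))
    (sym (∑-allSubsets-suc m _)))

  allSubsets-Unique : ∀ n → Unique (allSubsets n)
  allSubsets-Unique 0       = [] ∷ []
  allSubsets-Unique (suc n) = Unique.++⁺
    (Unique.map⁺ ∷-injectiveʳ (allSubsets-Unique n))
    (Unique.map⁺ ∷-injectiveʳ (allSubsets-Unique n))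
    λ (p , q) → case ∈-map⁻ _ p , ∈-map⁻ _ q of λ { ((_ , _ , refl) , (_ , _ , ())) }

  preimage : (Fin m → Fin n) → Subset n → Subset m
  preimage f S = tabulate (lookup S ∘ f)

  module _ (π : Fin m ↔ Fin n) where
    open Inverse π

    preimage-from : ∀ S → preimage from (preimage to S) ≡ S
    preimage-from S = trans
      (tabulate-cong λ i → trans (lookup∘tabulate _ (from i)) (cong (lookup S) (strictlyInverseˡ i)))
      (tabulate∘lookup S)

    preimage-to : ∀ S → preimage to (preimage from S) ≡ S
    preimage-to S = trans
      (tabulate-cong λ i → trans (lookup∘tabulate _ (to i)) (cong (lookup S) (strictlyInverseʳ i)))
      (tabulate∘lookup S)

    -- Both lists are free of repetitions and contain every subset, hence agree as bags. This makes
    -- sums over all subsets invariant under relabelling.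
    preimage-↭ : map (preimage to) (allSubsets n) ↭ allSubsets m
    preimage-↭ = ∼bag⇒↭ (unique∧set⇒bag
      (Unique.map⁺ (λ {S} {U} eq → trans (sym (preimage-from S))
          (trans (cong (preimage from) eq) (preimage-from U))) (allSubsets-Unique n))
      (allSubsets-Unique m)
      (λ {S} → mk⇔ (λ _ → ∈-allSubsets S) λ _ →
        subst (_∈ₗ _) (preimage-to S) (∈-map⁺ (preimage to) (∈-allSubsets (preimage from S)))))

    ∑-preimage : ∀ f → ∑ (allSubsets m) f ≡ ∑[ S ← allSubsets n ] f (preimage to S)
    ∑-preimage f = trans (sym (sum-↭ (map⁺ f preimage-↭))) (∑-map (preimage to) (allSubsets n) f)

    ∣preimage∣ : ∀ S → ∣ preimage to S ∣ ≡ ∣ S ∣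
    ∣preimage∣ S = trans (∣∣≡sum (preimage to S)) (trans
      (sum-cong-≗ λ i → cong indicator (lookup∘tabulate (lookup S ∘ to) i))
      (trans (sym (sum-permute (indicator ∘ lookup S) π)) (sym (∣∣≡sum S))))
      where
      indicator : Bool → ℕ
      indicator b = if b then 1 else 0
      ∣∣≡sum : ∀ {k} (S : Subset k) → ∣ S ∣ ≡ sumᶠ (indicator ∘ lookup S)
      ∣∣≡sum []            = refl
      ∣∣≡sum (outside ∷ S) = ∣∣≡sum S
      ∣∣≡sum (inside ∷ S)  = cong suc (∣∣≡sum S)

  ∈-preimage : (f : Fin m → Fin n) {S : Subset n} → ∀ x → x ∈ preimage f S ⇔ f x ∈ S
  ∈-preimage f {S} x = mk⇔
    (λ p → lookup⇒[]= _ S (trans (sym (lookup∘tabulate _ x)) ([]=⇒lookup p)))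
    (λ p → lookup⇒[]= x _ (trans (lookup∘tabulate _ x) ([]=⇒lookup p)))

  ∣++∣ : (S : Subset m) (U : Subset n) → ∣ S ++ᵛ U ∣ ≡ ∣ S ∣ + ∣ U ∣
  ∣++∣ []            U = refl
  ∣++∣ (outside ∷ S) U = ∣++∣ S U
  ∣++∣ (inside ∷ S)  U = cong suc (∣++∣ S U)

  ∈-++ˡ : (S : Subset m) (U : Subset n) → ∀ x → x ∈ S ⇔ (x ↑ˡ n) ∈ (S ++ᵛ U)
  ∈-++ˡ S U x = mk⇔
    (λ p → lookup⇒[]= _ _ (trans (lookup-++ˡ S U x) ([]=⇒lookup p)))
    (λ p → lookup⇒[]= x _ (trans (sym (lookup-++ˡ S U x)) ([]=⇒lookup p)))

  ∈-++ʳ : (S : Subset m) (U : Subset n) → ∀ x → x ∈ U ⇔ (m ↑ʳ x) ∈ (S ++ᵛ U)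
  ∈-++ʳ S U x = mk⇔
    (λ p → lookup⇒[]= _ _ (trans (lookup-++ʳ S U x) ([]=⇒lookup p)))
    (λ p → lookup⇒[]= x _ (trans (sym (lookup-++ʳ S U x)) ([]=⇒lookup p)))

  -- Only U has to lie in the image of f, so the same statement serves isomorphisms and the
  -- inclusions of the two sides into `combine b G H`.
  connectedOn-⇔ : (G : Graph m) (H : Graph n) (f : Fin m → Fin n) → Injective _≡_ _≡_ f →
    (∀ u v → adj H (f u) (f v) ≡ adj G u v) → ∀ {S U} → (∀ x → x ∈ S ⇔ f x ∈ U) →
    (∀ {y} → y ∈ U → ∃[ x ] f x ≡ y) → ConnectedOn G S ⇔ ConnectedOn H U
  connectedOn-⇔ G H f inj pres {S} {U} mem surj = mk⇔ forth back
    where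
    push : ∀ {u v} → Star (InducedAdj G S) u v → Star (InducedAdj H U) (f u) (f v)
    push ε = ε
    push ((p , q , e) ◅ es) =
      (Equivalence.to (mem _) p , Equivalence.to (mem _) q , subst T (sym (pres _ _)) e) ◅ push es

    -- The end of the walk is a free y with an equation, so that induction on the walk applies;
    -- intermediate vertices lie in U and hence in the image of f.
    pull : ∀ {u y} → Star (InducedAdj H U) (f u) y → ∀ {v} → y ≡ f v → Star (InducedAdj G S) u v
    pull ε eq with refl ← inj eq = ε
    pull ((p , q , e) ◅ es) eq with x , refl ← surj q =
      (Equivalence.from (mem _) p , Equivalence.from (mem _) q , subst T (pres _ _) e) ◅ pull es eq

    forth : ConnectedOn G S → ConnectedOn H U
    forth ((x , x∈) , walks) = (f x , Equivalence.to (mem x) x∈) , walks′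
      where
      walks′ : ∀ u v → u ∈ U → v ∈ U → Star (InducedAdj H U) u v
      walks′ u v u∈ v∈ with x , refl ← surj u∈ | y , refl ← surj v∈ =
        push (walks x y (Equivalence.from (mem x) u∈) (Equivalence.from (mem y) v∈))

    back : ConnectedOn H U → ConnectedOn G S
    back ((y , y∈) , walks) with x , refl ← surj y∈ =
      (x , Equivalence.from (mem x) y∈) ,
      λ u v u∈ v∈ → pull (walks (f u) (f v) (Equivalence.to (mem u) u∈) (Equivalence.to (mem v) v∈)) refl

  nonempty-⇔ : (f : Fin m → Fin n) → ∀ {S U} → (∀ x → x ∈ S ⇔ f x ∈ U) →
    (∀ {y} → y ∈ U → ∃[ x ] f x ≡ y) → Nonempty S ⇔ Nonempty U
  nonempty-⇔ f mem surj = mk⇔ (λ (x , x∈) → f x , Equivalence.to (mem x) x∈) back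
    where
    back : Nonempty _ → Nonempty _
    back (y , y∈) with x , refl ← surj y∈ = x , Equivalence.from (mem x) y∈

  -- The empty set fails `ConnectedOn` as well; `Nonempty` keeps it out of both counts.
  Disconnected : Graph n → Subset n → Set
  Disconnected G S = Nonempty S × ¬ ConnectedOn G S

  disconnected? : (G : Graph n) (S : Subset n) → Dec (Disconnected G S)
  disconnected? G S = nonempty? S ×-dec ¬? (connectedOn? G S)

  disconnected-⇔ : (G : Graph m) (H : Graph n) (f : Fin m → Fin n) → Injective _≡_ _≡_ f →
    (∀ u v → adj H (f u) (f v) ≡ adj G u v) → ∀ {S U} → (∀ x → x ∈ S ⇔ f x ∈ U) →
    (∀ {y} → y ∈ U → ∃[ x ] f x ≡ y) → Disconnected G S ⇔ Disconnected H U
  disconnected-⇔ G H f inj pres mem surj = mk⇔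
    (λ (ne , ¬c) → Equivalence.to ne⇔ ne , ¬c ∘ Equivalence.from c⇔)
    (λ (ne , ¬c) → Equivalence.from ne⇔ ne , ¬c ∘ Equivalence.to c⇔)
    where
    ne⇔ = nonempty-⇔ f mem surj
    c⇔  = connectedOn-⇔ G H f inj pres mem surj

  -- With ω constantly 1 this is #d, with ω the identity it is w; a general ω carries both through
  -- each graph operation in one proof.
  weight : (ℕ → ℕ) → Graph n → ℕ
  weight {n} ω G = ∑[ S ← allSubsets n ] (if does (disconnected? G S) then ω ∣ S ∣ else 0)

  weight-≅ : ∀ ω {G : Graph m} {H : Graph n} → G ≅ H → weight ω G ≡ weight ω H
  weight-≅ {m} {n} ω {G} {H} G≅H = trans (∑-preimage π _) (∑-cong (allSubsets n) λ S →
    cong₂ (λ b k → if b then ω k else 0)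
      (does-⇔ (disconnected-⇔ G H to (to-injective π) (_≅_.preserves G≅H) (∈-preimage to)
          λ {y} _ → from y , strictlyInverseˡ y)
        (disconnected? G _) (disconnected? H _))
      (∣preimage∣ π S))
    where
    π : Fin m ↔ Fin n
    π = _≅_.bijection G≅H
    open Inverse π

  module _ (b : Bool) (G : Graph m) (H : Graph n) where

    disconnected-++ˡ : ∀ S → Disconnected (combine b G H) (S ++ᵛ ⊥) ⇔ Disconnected G S
    disconnected-++ˡ S = mk⇔ (Equivalence.from eqv) (Equivalence.to eqv)
      where
      surj : ∀ {y} → y ∈ S ++ᵛ ⊥ → ∃[ x ] x ↑ˡ n ≡ y
      surj {y} y∈ with side m n y
      ... | left u  = u , refl
      ... | right v = contradiction (Equivalence.from (∈-++ʳ S ⊥ v) y∈) ∉⊥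
      eqv : Disconnected G S ⇔ Disconnected (combine b G H) (S ++ᵛ ⊥)
      eqv = disconnected-⇔ G (combine b G H) (_↑ˡ n) (Fin.↑ˡ-injective n _ _) (adj-ˡˡ b G H) (∈-++ˡ S ⊥) surj

    disconnected-++ʳ : ∀ U → Disconnected (combine b G H) (⊥ ++ᵛ U) ⇔ Disconnected H U
    disconnected-++ʳ U = mk⇔ (Equivalence.from eqv) (Equivalence.to eqv)
      where
      surj : ∀ {y} → y ∈ ⊥ {m} ++ᵛ U → ∃[ x ] m ↑ʳ x ≡ y
      surj {y} y∈ with side m n y
      ... | left u  = contradiction (Equivalence.from (∈-++ˡ ⊥ U u) y∈) ∉⊥
      ... | right v = v , refl
      eqv : Disconnected H U ⇔ Disconnected (combine b G H) (⊥ ++ᵛ U)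
      eqv = disconnected-⇔ H (combine b G H) (m ↑ʳ_) (Fin.↑ʳ-injective m _ _) (adj-ʳʳ b G H) (∈-++ʳ ⊥ U) surj

  module _ (G : Graph m) (H : Graph n) {S : Subset m} {U : Subset n} where

    ⋈-connectedOn : Nonempty S → Nonempty U → ConnectedOn (G ⋈ H) (S ++ᵛ U)
    ⋈-connectedOn (s , s∈) (t , t∈) = (s ↑ˡ n , inˡ s∈) , walk
      where
      inˡ : ∀ {x} → x ∈ S → x ↑ˡ n ∈ S ++ᵛ U
      inˡ = Equivalence.to (∈-++ˡ S U _)
      inʳ : ∀ {x} → x ∈ U → m ↑ʳ x ∈ S ++ᵛ U
      inʳ = Equivalence.to (∈-++ʳ S U _)
      T-≡ : ∀ {b} → b ≡ true → T b
      T-≡ refl = _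
      lr : ∀ {x y} → x ∈ S → y ∈ U → InducedAdj (G ⋈ H) (S ++ᵛ U) (x ↑ˡ n) (m ↑ʳ y)
      lr x∈ y∈ = inˡ x∈ , inʳ y∈ , T-≡ (adj-ˡʳ true G H _ _)
      rl : ∀ {x y} → x ∈ U → y ∈ S → InducedAdj (G ⋈ H) (S ++ᵛ U) (m ↑ʳ x) (y ↑ˡ n)
      rl x∈ y∈ = inʳ x∈ , inˡ y∈ , T-≡ (adj-ʳˡ true G H _ _)
      walk : ∀ u v → u ∈ S ++ᵛ U → v ∈ S ++ᵛ U → Star (InducedAdj (G ⋈ H) (S ++ᵛ U)) u v
      walk u v u∈ v∈ with side m n u | side m n v
      ... | left x  | right y = lr (Equivalence.from (∈-++ˡ S U x) u∈) (Equivalence.from (∈-++ʳ S U y) v∈) ◅ ε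
      ... | right x | left y  = rl (Equivalence.from (∈-++ʳ S U x) u∈) (Equivalence.from (∈-++ˡ S U y) v∈) ◅ ε
      ... | left x  | left y  =
        lr (Equivalence.from (∈-++ˡ S U x) u∈) t∈ ◅ rl t∈ (Equivalence.from (∈-++ˡ S U y) v∈) ◅ ε
      ... | right x | right y =
        rl (Equivalence.from (∈-++ʳ S U x) u∈) s∈ ◅ lr s∈ (Equivalence.from (∈-++ʳ S U y) v∈) ◅ ε

    ⊍-stays-left : ∀ {x y} → Star (InducedAdj (G ⊍ H) (S ++ᵛ U)) (x ↑ˡ n) y → ∃[ x′ ] x′ ↑ˡ n ≡ y
    ⊍-stays-left {x} ε = x , refl
    ⊍-stays-left {x} (_◅_ {j = y} (_ , _ , e) es) with side m n y
    ... | left _  = ⊍-stays-left es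
    ... | right v = contradiction (subst T (adj-ˡʳ false G H x v) e) λ ()

    ⊍-¬connectedOn : Nonempty S → Nonempty U → ¬ ConnectedOn (G ⊍ H) (S ++ᵛ U)
    ⊍-¬connectedOn (s , s∈) (t , t∈) (_ , walk)
      with x , eq ← ⊍-stays-left (walk (s ↑ˡ n) (m ↑ʳ t)
                            (Equivalence.to (∈-++ˡ S U s) s∈) (Equivalence.to (∈-++ʳ S U t) t∈))
      = case trans (sym (Fin.splitAt-↑ˡ m x n)) (trans (cong (splitAt m) eq) (Fin.splitAt-↑ʳ m n t))
        of λ ()

  ¬disconnected-⊥ : (G : Graph n) → ¬ Disconnected G ⊥
  ¬disconnected-⊥ G ((_ , x∈) , _) = ∉⊥ x∈

  if-no : {P : Set} (P? : Dec P) → ¬ P → ∀ {x} → (if does P? then x else 0) ≡ 0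
  if-no P? ¬p = cong (λ b → if b then _ else 0) (dec-false P? ¬p)

  if-yes : {P : Set} (P? : Dec P) → P → ∀ {x y : ℕ} → (if does P? then x else y) ≡ x
  if-yes P? p = cong (λ b → if b then _ else _) (dec-true P? p)

  weight-nonempties : ∀ ω (G : Graph n) →
    weight ω G ≡ ∑[ S ← nonempties n ] (if does (disconnected? G S) then ω ∣ S ∣ else 0)
  weight-nonempties {n} ω G = ∑-allSubsets-⊥≡0 n _
    (if-no (disconnected? G ⊥) (¬disconnected-⊥ G))

  -- A set inside one side is disconnected in the combination exactly when it is so in that side. A
  -- set meeting both sides is always connected in a join and never in a disjoint union, whatever
  -- the sides look like.
  weight-combine : ∀ ω b (G : Graph m) (H : Graph n) →
    weight ω (combine b G H) ≡ weight ω G + weight ω H +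
      (∑[ S ← nonempties m ] ∑[ U ← nonempties n ] (if b then 0 else ω (∣ S ∣ + ∣ U ∣)))
  weight-combine {m} {n} ω b G H = begin
    weight ω (combine b G H)
      ≡⟨ ∑-allSubsets-++ m n f ⟩
    ∑[ S ← allSubsets m ] ∑[ U ← allSubsets n ] f (S ++ᵛ U)
      ≡⟨ ∑-allSubsets m _ ⟩
    ∑[ U ← allSubsets n ] f (⊥ {m} ++ᵛ U) + ∑[ S ← nonempties m ] ∑[ U ← allSubsets n ] f (S ++ᵛ U)
      ≡⟨ cong₂ _+_ (∑-cong (allSubsets n) onʳ)
          (∑-cong-All (All.map (λ {S} S≠⊥ → trans (∑-allSubsets n _)
            (cong₂ _+_ (onˡ S) (∑-cong-All (All.map (across b S≠⊥) (nonempties-Nonempty n)))))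
            (nonempties-Nonempty m))) ⟩
    weight ω H + ∑[ S ← nonempties m ] (g S + ∑[ U ← nonempties n ] h S U)
      ≡⟨ cong (weight ω H +_) (∑-+ (nonempties m) _ _) ⟩
    weight ω H + (∑ (nonempties m) g + ∑[ S ← nonempties m ] ∑[ U ← nonempties n ] h S U)
      ≡⟨ cong (λ x → weight ω H + (x + ∑[ S ← nonempties m ] ∑[ U ← nonempties n ] h S U))
           (sym (weight-nonempties ω G)) ⟩
    weight ω H + (weight ω G + ∑[ S ← nonempties m ] ∑[ U ← nonempties n ] h S U)
      ≡⟨ rearrange (weight ω H) (weight ω G) _ ⟩
    weight ω G + weight ω H + ∑[ S ← nonempties m ] ∑[ U ← nonempties n ] h S U ∎
    where
    open ≡-Reasoning
    rearrange : ∀ a b c → a + (b + c) ≡ b + a + c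
    rearrange = solve-∀

    f : Subset (m + n) → ℕ
    f S = if does (disconnected? (combine b G H) S) then ω ∣ S ∣ else 0
    g : Subset m → ℕ
    g S = if does (disconnected? G S) then ω ∣ S ∣ else 0
    h : Subset m → Subset n → ℕ
    h S U = if b then 0 else ω (∣ S ∣ + ∣ U ∣)

    onʳ : ∀ U → f (⊥ {m} ++ᵛ U) ≡ (if does (disconnected? H U) then ω ∣ U ∣ else 0)
    onʳ U = cong₂ (λ b k → if b then ω k else 0)
      (does-⇔ (disconnected-++ʳ b G H U) (disconnected? (combine b G H) _) (disconnected? H U))
      (trans (∣++∣ (⊥ {m}) U) (cong (_+ ∣ U ∣) (∣⊥∣≡0 m)))
    onˡ : ∀ S → f (S ++ᵛ ⊥) ≡ g S
    onˡ S = cong₂ (λ b k → if b then ω k else 0)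
      (does-⇔ (disconnected-++ˡ b G H S) (disconnected? (combine b G H) _) (disconnected? G S))
      (trans (∣++∣ S ⊥) (trans (cong (∣ S ∣ +_) (∣⊥∣≡0 n)) (+-identityʳ _)))
    across : ∀ b {S U} → Nonempty S → Nonempty U →
      (if does (disconnected? (combine b G H) (S ++ᵛ U)) then ω ∣ S ++ᵛ U ∣ else 0) ≡
      (if b then 0 else ω (∣ S ∣ + ∣ U ∣))
    across true  {S} {U} S≠⊥ U≠⊥ = if-no (disconnected? (G ⋈ H) (S ++ᵛ U))
      λ (_ , ¬c) → ¬c (⋈-connectedOn G H S≠⊥ U≠⊥)
    across false {S} {U} S≠⊥@(s , s∈) U≠⊥ = trans
      (if-yes (disconnected? (G ⊍ H) (S ++ᵛ U))
        ((s ↑ˡ n , Equivalence.to (∈-++ˡ S U s) s∈) , ⊍-¬connectedOn G H S≠⊥ U≠⊥))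
      (cong ω (∣++∣ S U))

  complete⇒connectedOn : {G : Graph n} → Complete G → ∀ {S} → Nonempty S → ConnectedOn G S
  complete⇒connectedOn {G = G} complete {S} S≠⊥ = S≠⊥ , walk
    where
    walk : ∀ u v → u ∈ S → v ∈ S → Star (InducedAdj G S) u v
    walk u v u∈ v∈ with u Fin.≟ v
    ... | yes refl = ε
    ... | no u≢v   = (u∈ , v∈ , subst T (sym (complete u v u≢v)) _) ◅ ε

  weight-complete : ∀ ω {G : Graph n} → Complete G → weight ω G ≡ 0
  weight-complete {n} ω {G} complete = trans
    (∑-cong (allSubsets n) λ S → if-no (disconnected? G S)
      λ (S≠⊥ , ¬c) → ¬c (complete⇒connectedOn {G = G} complete S≠⊥))
    (∑-0 (allSubsets n))

  -- In closed form 2ⁿ - 1 and n·2ⁿ⁻¹; `suc-N` and `2*W` express this without subtraction or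
  -- halving.
  N W : ℕ → ℕ
  N n = ∑[ S ← nonempties n ] 1
  W n = ∑[ S ← nonempties n ] ∣ S ∣

  ∑-allSubsets-1 : ∀ n → ∑[ S ← allSubsets n ] 1 ≡ 2 ^ n
  ∑-allSubsets-1 0       = refl
  ∑-allSubsets-1 (suc n) = trans (∑-allSubsets-suc n _) (trans
    (cong₂ _+_ (∑-allSubsets-1 n) (∑-allSubsets-1 n)) (cong (2 ^ n +_) (sym (+-identityʳ (2 ^ n)))))

  suc-N : ∀ n → suc (N n) ≡ 2 ^ n
  suc-N n = trans (sym (∑-allSubsets n _)) (∑-allSubsets-1 n)

  -- A set and its complement have sizes adding up to n; the induction reaches the same total by
  -- splitting on whether the first vertex belongs to the set.
  2*∑∣∣ : ∀ n → 2 * ∑[ S ← allSubsets n ] ∣ S ∣ ≡ n * 2 ^ n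
  2*∑∣∣ 0       = refl
  2*∑∣∣ (suc n) = begin
    2 * ∑[ S ← allSubsets (suc n) ] ∣ S ∣ ≡⟨ cong (2 *_) (∑-allSubsets-suc n _) ⟩
    2 * (w + ∑[ S ← allSubsets n ] (1 + ∣ S ∣))
      ≡⟨ cong (λ x → 2 * (w + x)) (∑-+ (allSubsets n) _ _) ⟩
    2 * (w + (∑[ S ← allSubsets n ] 1 + w)) ≡⟨ cong (λ x → 2 * (w + (x + w))) (∑-allSubsets-1 n) ⟩
    2 * (w + (2 ^ n + w))                   ≡⟨ split w (2 ^ n) ⟩
    2 * (2 * w) + 2 * 2 ^ n                 ≡⟨ cong (λ x → 2 * x + 2 * 2 ^ n) (2*∑∣∣ n) ⟩
    2 * (n * 2 ^ n) + 2 * 2 ^ n             ≡⟨ collect n (2 ^ n) ⟩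
    suc n * 2 ^ suc n                       ∎
    where
    open ≡-Reasoning
    w = ∑[ S ← allSubsets n ] ∣ S ∣
    split : ∀ a q → 2 * (a + (q + a)) ≡ 2 * (2 * a) + 2 * q
    split = solve-∀
    collect : ∀ n q → 2 * (n * q) + 2 * q ≡ suc n * (2 * q)
    collect = solve-∀

  2*W : ∀ n → 2 * W n ≡ n * suc (N n)
  2*W n = trans (cong (2 *_) (sym (trans (∑-allSubsets n _) (cong (_+ W n) (∣⊥∣≡0 n)))))
    (trans (2*∑∣∣ n) (cong (n *_) (sym (suc-N n))))

  #disc : Graph n → ℕ
  #disc = weight (const 1)

  ∑disc : Graph n → ℕ
  ∑disc = weight (λ k → k)

  ∑∑-0 : ∀ m n → ∑[ S ← nonempties m ] ∑[ U ← nonempties n ] 0 ≡ 0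
  ∑∑-0 m n = trans (∑-cong (nonempties m) λ _ → ∑-0 (nonempties n)) (∑-0 (nonempties m))

  weight-⋈ : ∀ ω (G : Graph m) (H : Graph n) → weight ω (G ⋈ H) ≡ weight ω G + weight ω H
  weight-⋈ {m} {n} ω G H = trans (weight-combine ω true G H)
    (trans (cong (weight ω G + weight ω H +_) (∑∑-0 m n)) (+-identityʳ _))

  #disc-⊍ : (G : Graph m) (H : Graph n) → #disc (G ⊍ H) ≡ #disc G + #disc H + N m * N n
  #disc-⊍ {m} {n} G H = trans (weight-combine (const 1) false G H)
    (cong (#disc G + #disc H +_) (trans
      (∑-cong (nonempties m) λ _ → sym (*-identityˡ (N n))) (∑-*ʳ (nonempties m) (N n) (const 1))))

  -- Doubling lets `2*W` rewrite the cross term W m · N n + W n · N m in terms of `N` alone.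
  2*∑disc-⊍ : (G : Graph m) (H : Graph n) → 2 * ∑disc (G ⊍ H) ≡
    2 * ∑disc G + 2 * ∑disc H + (m * suc (N m) * N n + n * suc (N n) * N m)
  2*∑disc-⊍ {m} {n} G H = begin
    2 * ∑disc (G ⊍ H) ≡⟨ cong (2 *_) (weight-combine (λ k → k) false G H) ⟩
    2 * (∑disc G + ∑disc H + ∑[ S ← nonempties m ] ∑[ U ← nonempties n ] (∣ S ∣ + ∣ U ∣))
      ≡⟨ cong (λ x → 2 * (∑disc G + ∑disc H + x)) double ⟩
    2 * (∑disc G + ∑disc H + (W m * N n + W n * N m))
      ≡⟨ expand (∑disc G) (∑disc H) (W m) (W n) (N m) (N n) ⟩
    2 * ∑disc G + 2 * ∑disc H + (2 * W m * N n + 2 * W n * N m)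
      ≡⟨ cong₂ (λ x y → 2 * ∑disc G + 2 * ∑disc H + (x * N n + y * N m)) (2*W m) (2*W n) ⟩
    _ ∎
    where
    open ≡-Reasoning
    expand : ∀ a b c d e f → 2 * (a + b + (c * f + d * e)) ≡ 2 * a + 2 * b + (2 * c * f + 2 * d * e)
    expand = solve-∀
    double : ∑[ S ← nonempties m ] ∑[ U ← nonempties n ] (∣ S ∣ + ∣ U ∣) ≡ W m * N n + W n * N m
    double = trans
      (∑-cong (nonempties m) λ S → trans (∑-+ (nonempties n) (const ∣ S ∣) ∣_∣)
        (cong (_+ W n) (trans (∑-cong (nonempties n) λ _ → sym (*-identityʳ ∣ S ∣))
          (∑-*ˡ (nonempties n) ∣ S ∣ (const 1)))))
      (trans (∑-+ (nonempties m) _ _) (cong₂ _+_ (∑-*ʳ (nonempties m) (N n) ∣_∣)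
        (trans (∑-cong (nonempties m) λ _ → sym (*-identityʳ (W n)))
          (∑-*ˡ (nonempties m) (W n) (const 1)))))

  -- Connected sets and the values Φ(1) and Φ′(1)

  connWeight : (ℕ → ℕ) → Graph n → ℕ
  connWeight {n} ω G = ∑[ S ← allSubsets n ] (if does (connectedOn? G S) then ω ∣ S ∣ else 0)

  connWeight+weight : ∀ ω (G : Graph n) →
    connWeight ω G + weight ω G ≡ ∑[ S ← nonempties n ] ω ∣ S ∣
  connWeight+weight {n} ω G = begin
    connWeight ω G + weight ω G
      ≡⟨ cong₂ _+_ (∑-allSubsets-⊥≡0 n _ (if-no (connectedOn? G ⊥) λ c → ∉⊥ (proj₂ (proj₁ c))))
                   (weight-nonempties ω G) ⟩
    ∑[ S ← nonempties n ] (if does (connectedOn? G S) then ω ∣ S ∣ else 0)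
      + ∑[ S ← nonempties n ] (if does (disconnected? G S) then ω ∣ S ∣ else 0)
      ≡⟨ sym (∑-+ (nonempties n) _ _) ⟩
    ∑[ S ← nonempties n ] ((if does (connectedOn? G S) then ω ∣ S ∣ else 0)
      + (if does (disconnected? G S) then ω ∣ S ∣ else 0))
      ≡⟨ ∑-cong-All (All.map (λ {S} → one S) (nonempties-Nonempty n)) ⟩
    ∑[ S ← nonempties n ] ω ∣ S ∣ ∎
    where
    open ≡-Reasoning
    one : ∀ S → Nonempty S → (if does (connectedOn? G S) then ω ∣ S ∣ else 0)
      + (if does (disconnected? G S) then ω ∣ S ∣ else 0) ≡ ω ∣ S ∣
    one S S≠⊥ = case connectedOn? G S of λ
      { (yes c) → trans (cong₂ _+_ (if-yes (connectedOn? G S) c)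
                                   (if-no (disconnected? G S) λ (_ , ¬c) → ¬c c)) (+-identityʳ _)
      ; (no ¬c) → cong₂ _+_ (if-no (connectedOn? G S) ¬c) (if-yes (disconnected? G S) (S≠⊥ , ¬c)) }

  sum-applyUpTo-+ : ∀ (f g : ℕ → ℕ) n →
    sum (applyUpTo (λ i → f i + g i) n) ≡ sum (applyUpTo f n) + sum (applyUpTo g n)
  sum-applyUpTo-+ f g 0       = refl
  sum-applyUpTo-+ f g (suc n) =
    trans (cong (f 0 + g 0 +_) (sum-applyUpTo-+ (f ∘ suc) (g ∘ suc) n))
          (+-interchange (f 0) (g 0) _ _)

  sum-applyUpTo-0 : ∀ {f : ℕ → ℕ} n → (∀ i → f i ≡ 0) → sum (applyUpTo f n) ≡ 0
  sum-applyUpTo-0 0       f≗0 = refl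
  sum-applyUpTo-0 (suc n) f≗0 = cong₂ _+_ (f≗0 0) (sum-applyUpTo-0 n (f≗0 ∘ suc))

  sum-applyUpTo-cong : ∀ {f g : ℕ → ℕ} n → (∀ i → f i ≡ g i) →
    sum (applyUpTo f n) ≡ sum (applyUpTo g n)
  sum-applyUpTo-cong 0       eq = refl
  sum-applyUpTo-cong (suc n) eq = cong₂ _+_ (eq 0) (sum-applyUpTo-cong n (eq ∘ suc))

  sum-applyUpTo-single : ∀ {f : ℕ → ℕ} {k} n → k < n → (∀ i → i ≢ k → f i ≡ 0) →
    sum (applyUpTo f n) ≡ f k
  sum-applyUpTo-single {k = zero} (suc n) _ off =
    trans (cong (_ +_) (sum-applyUpTo-0 n λ i → off (suc i) λ ())) (+-identityʳ _)
  sum-applyUpTo-single {f} {suc k} (suc n) (s≤s k<n) off =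
    cong₂ _+_ (off 0 λ ()) (sum-applyUpTo-single n k<n λ i i≢k → off (suc i) (i≢k ∘ suc-injective))

  length-filter : {P : A → Set} (P? : ∀ x → Dec (P x)) (xs : List A) →
    length (filter P? xs) ≡ ∑[ x ← xs ] (if does (P? x) then 1 else 0)
  length-filter P? [] = refl
  length-filter P? (x ∷ xs) with does (P? x)
  ... | true  = cong suc (length-filter P? xs)
  ... | false = length-filter P? xs

  Nonempty⇒∣∣≡suc : {S : Subset n} → Nonempty S → ∃[ k ] ∣ S ∣ ≡ suc k
  Nonempty⇒∣∣≡suc {S = inside ∷ S}  _                   = ∣ S ∣ , refl
  Nonempty⇒∣∣≡suc {S = outside ∷ S} (suc i , there i∈) = Nonempty⇒∣∣≡suc (i , i∈)

  -- After exchanging the sums, a connected set S contributes at the single index i with i + 1 =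
  -- ∣S∣. Such an index exists because connected sets are nonempty. Constant ω yields Φ(1), the
  -- identity yields Φ′(1).
  ∑ω*a : ∀ (ω : ℕ → ℕ) (G : Graph n) →
    sum (applyUpTo (λ i → ω (suc i) * a (suc i) G) n) ≡ connWeight ω G
  ∑ω*a {n} ω G = trans
    (sum-applyUpTo-cong n λ i → cong (ω (suc i) *_) (length-filter _ (allSubsets n)))
    (go (allSubsets n))
    where
    sized? : ∀ k (S : Subset n) → Dec (∣ S ∣ ≡ k × ConnectedOn G S)
    sized? k S = (∣ S ∣ ≟ k) ×-dec connectedOn? G S
    χ : ℕ → Subset n → ℕ
    χ i S = if does (sized? i S) then 1 else 0
    one : ∀ S → sum (applyUpTo (λ i → ω (suc i) * χ (suc i) S) n) ≡
                (if does (connectedOn? G S) then ω ∣ S ∣ else 0)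
    one S = case connectedOn? G S of λ
      { (no ¬c) → trans (sum-applyUpTo-0 n λ i → trans
          (cong (ω (suc i) *_) (if-no (sized? (suc i) S) λ (_ , c) → ¬c c)) (*-zeroʳ (ω (suc i))))
          (sym (if-no (connectedOn? G S) ¬c))
      ; (yes c) → let k , eq = Nonempty⇒∣∣≡suc (proj₁ c) in trans
          (sum-applyUpTo-single n (subst (_≤ n) eq (∣p∣≤n S)) λ i i≢k → trans
            (cong (ω (suc i) *_) (if-no (sized? (suc i) S)
              λ (eq′ , _) → i≢k (suc-injective (trans (sym eq′) eq)))) (*-zeroʳ (ω (suc i))))
          (trans (cong (ω (suc k) *_) (if-yes (sized? (suc k) S) (eq , c)))
            (trans (*-identityʳ _) (trans (cong ω (sym eq)) (sym (if-yes (connectedOn? G S) c))))) }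
    go : ∀ Ss → sum (applyUpTo (λ i → ω (suc i) * ∑ Ss (χ (suc i))) n) ≡
                ∑[ S ← Ss ] (if does (connectedOn? G S) then ω ∣ S ∣ else 0)
    go []       = sum-applyUpTo-0 n λ i → *-zeroʳ (ω (suc i))
    go (S ∷ Ss) = trans
      (sum-applyUpTo-cong n λ i → *-distribˡ-+ (ω (suc i)) (χ (suc i) S) _)
      (trans (sum-applyUpTo-+ (λ i → ω (suc i) * χ (suc i) S) _ n) (cong₂ _+_ (one S) (go Ss)))

  eval-1 : ∀ cs → eval cs 1 ≡ sum cs
  eval-1 []       = refl
  eval-1 (c ∷ cs) = cong (c +_) (trans (+-identityʳ _) (eval-1 cs))

  zipWith-applyUpTo : ∀ (h : ℕ → ℕ → ℕ) f g n →
    zipWith h (applyUpTo f n) (applyUpTo g n) ≡ applyUpTo (λ i → h (f i) (g i)) n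
  zipWith-applyUpTo h f g 0       = refl
  zipWith-applyUpTo h f g (suc n) = cong (h (f 0) (g 0) ∷_) (zipWith-applyUpTo h (f ∘ suc) (g ∘ suc) n)

  Φ[1] : (G : Graph n) → eval (Φ G) 1 ≡ connWeight (const 1) G
  Φ[1] {n} G = trans (eval-1 (Φ G))
    (trans (sum-applyUpTo-cong n λ i → sym (*-identityˡ (a (suc i) G))) (∑ω*a (const 1) G))

  Φ′[1] : (G : Graph n) → eval (derivative (Φ G)) 1 ≡ connWeight (λ k → k) G
  Φ′[1] {n} G = trans (eval-1 (derivative (Φ G))) (trans
    (cong sum (trans
      (cong (λ k → zipWith _*_ (applyUpTo suc k) (applyUpTo (λ i → a (suc i) G) n))
        (length-applyUpTo (λ i → a (suc i) G) n))
      (zipWith-applyUpTo _*_ suc (λ i → a (suc i) G) n)))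
    (∑ω*a (λ k → k) G))

  Φ[1]+#disc : (G : Graph n) → suc (eval (Φ G) 1 + #disc G) ≡ 2 ^ n
  Φ[1]+#disc {n} G =
    trans (cong (λ s → suc (s + #disc G)) (Φ[1] G)) (trans
      (cong suc (connWeight+weight (const 1) G)) (suc-N n))

  -- 2 Φ′(1) ∸ n Φ(1) = n + n #disc ∸ 2 ∑disc, freed of subtractions.
  excess : (G : Graph n) →
    2 * eval (derivative (Φ G)) 1 + 2 * ∑disc G ≡ n * eval (Φ G) 1 + (n + n * #disc G)
  excess {n} G = begin
    2 * p + 2 * ∑disc G       ≡⟨ sym (*-distribˡ-+ 2 p _) ⟩
    2 * (p + ∑disc G)         ≡⟨ cong (2 *_) (trans (cong (_+ ∑disc G) (Φ′[1] G))
                                   (connWeight+weight (λ k → k) G)) ⟩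
    2 * W n                   ≡⟨ 2*W n ⟩
    n * suc (N n)             ≡⟨ cong (n *_) (trans (suc-N n) (sym (Φ[1]+#disc G))) ⟩
    n * suc (s + #disc G)     ≡⟨ expand n s (#disc G) ⟩
    n * s + (n + n * #disc G) ∎
    where
    open ≡-Reasoning
    p = eval (derivative (Φ G)) 1
    s = eval (Φ G) 1
    expand : ∀ n s d → n * suc (s + d) ≡ n * s + (n + n * d)
    expand = solve-∀

  -- The excess 2 Φ′(1) − n Φ(1)

  N-suc : ∀ n → N (suc n) ≡ suc (2 * N n)
  N-suc n = suc-injective (begin
    suc (N (suc n))     ≡⟨ suc-N (suc n) ⟩
    2 * 2 ^ n           ≡⟨ cong (2 *_) (sym (suc-N n)) ⟩
    2 * suc (N n)       ≡⟨ *-suc 2 (N n) ⟩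
    suc (suc (2 * N n)) ∎)
    where open ≡-Reasoning

  n≤N : ∀ n → n ≤ N n
  n≤N 0       = z≤n
  n≤N (suc n) rewrite N-suc n = s≤s (≤-trans (n≤N n) (m≤m+n (N n) _))

  -- The threshold 3 is sharp, as `N 2` is 3. Order 2 is therefore exceptional in the estimates for
  -- cones.
  2n<N : ∀ k → 2 * (3 + k) < N (3 + k)
  2n<N 0       = ≤-refl
  2n<N (suc k) rewrite N-suc (3 + k) = begin-strict
    2 * (4 + k)             ≡⟨ trans (*-suc 2 (3 + k)) (+-comm 2 _) ⟩
    2 * (3 + k) + 2         ≤⟨ +-monoʳ-≤ (2 * (3 + k)) (s≤s (s≤s z≤n)) ⟩
    2 * (3 + k) + 2 * (3 + k) <⟨ +-mono-< (2n<N k) (2n<N k) ⟩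
    N (3 + k) + N (3 + k)   ≡⟨ cong (N (3 + k) +_) (sym (+-identityʳ _)) ⟩
    2 * N (3 + k)           <⟨ n<1+n _ ⟩
    suc (2 * N (3 + k))     ∎
    where open ≤-Reasoning

  n<N : ∀ {n} → 2 ≤ n → n < N n
  n<N {1} (s≤s ())
  n<N {2} _                 = s≤s (s≤s (s≤s z≤n))
  n<N {suc (suc (suc k))} _ = ≤-<-trans (m≤m+n _ _) (2n<N k)

  K₁-weight : ∀ ω → weight ω (K 1) ≡ 0
  K₁-weight ω = weight-complete ω {G = K 1} (K-complete 1)

  -- pair stands for 2K₁, of which only the order and the two counts matter.
  data Kind (G : Graph n) : Set where
    complete : Complete G → Kind G
    pair     : n ≡ 2 → #disc G ≡ 1 → 2 * ∑disc G ≡ 4 → Kind G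
    strict   : 2 * ∑disc G < (n + 2) * #disc G → Kind G

  2*∑disc≤ : {G : Graph n} → Kind G → 2 * ∑disc G ≤ (n + 2) * #disc G
  2*∑disc≤ {n} {G} (complete c) =
    subst (λ w → 2 * w ≤ (n + 2) * #disc G) (sym (weight-complete (λ k → k) {G = G} c)) z≤n
  2*∑disc≤ (pair refl d w) = ≤-reflexive (trans w (cong (4 *_) (sym d)))
  2*∑disc≤ (strict lt) = <⇒≤ lt

  #disc>0 : {G : Graph n} → Kind G → Complete G ⊎ 0 < #disc G
  #disc>0 (complete c)   = inj₁ c
  #disc>0 (pair _ d _)   = inj₂ (subst (0 <_) (sym d) z<s)
  #disc>0 {n} {G} (strict lt) = inj₂ (n≢0⇒n>0 λ d≡0 →
    n≮0 (subst (2 * ∑disc G <_) (trans (cong ((n + 2) *_) d≡0) (*-zeroʳ (n + 2))) lt))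

  size>0 : ∀ {V} (t : Cotree V) → 0 < size t
  size>0 (leaf _)     = z<s
  size>0 (node _ l r) = <-≤-trans (size>0 l) (m≤m+n _ _)

  N>0 : 0 < n → 0 < N n
  N>0 {n} 0<n = <-≤-trans 0<n (n≤N n)

  2*∑disc-⋈ : (G : Graph m) (H : Graph n) → 2 * ∑disc (G ⋈ H) ≡ 2 * ∑disc G + 2 * ∑disc H
  2*∑disc-⋈ G H = trans (cong (2 *_) (weight-⋈ (λ k → k) G H)) (*-distribˡ-+ 2 (∑disc G) (∑disc H))

  -- Raising the coefficients m + 2 and n + 2 to m + n + 2 gains n x + m y, which is positive as
  -- soon as either side has a disconnected set.
  ⋈-strict : (G : Graph m) (H : Graph n) → Kind G → Kind H → 0 < m → 0 < n →
    0 < #disc G + #disc H → 2 * ∑disc (G ⋈ H) < (m + n + 2) * #disc (G ⋈ H)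
  ⋈-strict {m} {n} G H kG kH 0<m 0<n 0<d = begin-strict
    2 * ∑disc (G ⋈ H)                     ≡⟨ 2*∑disc-⋈ G H ⟩
    2 * ∑disc G + 2 * ∑disc H             ≤⟨ +-mono-≤ (2*∑disc≤ kG) (2*∑disc≤ kH) ⟩
    (m + 2) * x + (n + 2) * y             ≡⟨ sym (+-identityʳ _) ⟩
    (m + 2) * x + (n + 2) * y + 0         <⟨ +-monoʳ-< ((m + 2) * x + (n + 2) * y) cross ⟩
    (m + 2) * x + (n + 2) * y + (n * x + m * y) ≡⟨ regroup m n x y ⟩
    (m + n + 2) * (x + y)                 ≡⟨ cong ((m + n + 2) *_) (sym (weight-⋈ (const 1) G H)) ⟩
    (m + n + 2) * #disc (G ⋈ H)           ∎
    where
    open ≤-Reasoning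
    x = #disc G
    y = #disc H
    regroup : ∀ m n x y → (m + 2) * x + (n + 2) * y + (n * x + m * y) ≡ (m + n + 2) * (x + y)
    regroup = solve-∀
    cross : 0 < n * x + m * y
    cross = <-≤-trans 0<d (+-mono-≤ (m≤n*m x n {{>-nonZero 0<n}}) (m≤n*m y m {{>-nonZero 0<m}}))

  -- At equality one has m = N m and n = N n, which leaves only m = n = 1.
  cross-bound : ∀ {m n X Y} → 0 < X → 0 < Y → m ≤ X → n ≤ Y → m < X ⊎ n < Y →
    m * Y + n * X < 2 * (X * Y)
  cross-bound {m} {n} {X} {Y} 0<X 0<Y m≤X n≤Y lt = begin-strict
    m * Y + n * X     <⟨ go lt ⟩
    X * Y + Y * X     ≡⟨ cong (X * Y +_) (trans (*-comm Y X) (sym (+-identityʳ (X * Y)))) ⟩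
    2 * (X * Y)       ∎
    where
    open ≤-Reasoning
    go : m < X ⊎ n < Y → m * Y + n * X < X * Y + Y * X
    go (inj₁ m<X) = +-mono-<-≤ (*-monoˡ-< Y {{>-nonZero 0<Y}} m<X) (*-monoˡ-≤ X n≤Y)
    go (inj₂ n<Y) = +-mono-≤-< (*-monoˡ-≤ Y m≤X) (*-monoˡ-< X {{>-nonZero 0<X}} n<Y)

  -- Sets meeting both sides add (m + n) X Y + m Y + n X to the left and (m + n + 2) X Y to the
  -- right, so `cross-bound` decides. A side of order at least 2 rules out 2K₁, where equality
  -- holds.
  ⊍-strict : (G : Graph m) (H : Graph n) → Kind G → Kind H → 0 < m → 0 < n →
    2 ≤ m ⊎ 2 ≤ n → 2 * ∑disc (G ⊍ H) < (m + n + 2) * #disc (G ⊍ H)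
  ⊍-strict {m} {n} G H kG kH 0<m 0<n big = begin-strict
    2 * ∑disc (G ⊍ H)
      ≡⟨ 2*∑disc-⊍ G H ⟩
    2 * ∑disc G + 2 * ∑disc H + (m * suc X * Y + n * suc Y * X)
      ≤⟨ +-monoˡ-≤ _ (+-mono-≤ (2*∑disc≤ kG) (2*∑disc≤ kH)) ⟩
    (m + 2) * x + (n + 2) * y + (m * suc X * Y + n * suc Y * X)
      ≡⟨ expand m n x y X Y ⟩
    (m + 2) * x + (n + 2) * y + (m + n) * (X * Y) + (m * Y + n * X)
      <⟨ +-monoʳ-< ((m + 2) * x + (n + 2) * y + (m + n) * (X * Y))
         (cross-bound (N>0 0<m) (N>0 0<n) (n≤N m) (n≤N n) (grow big)) ⟩
    (m + 2) * x + (n + 2) * y + (m + n) * (X * Y) + 2 * (X * Y)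
      ≤⟨ m≤m+n _ (n * x + m * y) ⟩
    (m + 2) * x + (n + 2) * y + (m + n) * (X * Y) + 2 * (X * Y) + (n * x + m * y)
      ≡⟨ regroup m n x y X Y ⟩
    (m + n + 2) * (x + y + X * Y)
      ≡⟨ cong ((m + n + 2) *_) (sym (#disc-⊍ G H)) ⟩
    (m + n + 2) * #disc (G ⊍ H) ∎
    where
    open ≤-Reasoning
    x = #disc G
    y = #disc H
    X = N m
    Y = N n
    grow : 2 ≤ m ⊎ 2 ≤ n → m < X ⊎ n < Y
    grow (inj₁ 2≤m) = inj₁ (n<N 2≤m)
    grow (inj₂ 2≤n) = inj₂ (n<N 2≤n)
    expand : ∀ m n x y X Y → (m + 2) * x + (n + 2) * y + (m * suc X * Y + n * suc Y * X) ≡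
      (m + 2) * x + (n + 2) * y + (m + n) * (X * Y) + (m * Y + n * X)
    expand = solve-∀
    regroup : ∀ m n x y X Y →
      (m + 2) * x + (n + 2) * y + (m + n) * (X * Y) + 2 * (X * Y) + (n * x + m * y) ≡
      (m + n + 2) * (x + y + X * Y)
    regroup = solve-∀

  2≤size-node : ∀ {V} b (l r : Cotree V) → 2 ≤ size (node b l r)
  2≤size-node b l r = +-mono-≤ (size>0 l) (size>0 r)

  kind : ∀ {V} (t : Cotree V) → Kind ⟦ t ⟧
  kind (leaf _) = complete (K-complete 1)
  kind (node true l r) with kind l | kind r
  ... | kl | kr with #disc>0 kl | #disc>0 kr
  ... | inj₁ cl | inj₁ cr = complete (⋈-complete ⟦ l ⟧ ⟦ r ⟧ cl cr)
  ... | inj₂ dl | _       = strict (⋈-strict ⟦ l ⟧ ⟦ r ⟧ kl kr (size>0 l) (size>0 r)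
                              (<-≤-trans dl (m≤m+n _ _)))
  ... | inj₁ _  | inj₂ dr = strict (⋈-strict ⟦ l ⟧ ⟦ r ⟧ kl kr (size>0 l) (size>0 r)
                              (<-≤-trans dr (m≤n+m _ (#disc ⟦ l ⟧))))
  kind (node false (leaf x) (leaf y)) = pair refl
    (trans (#disc-⊍ (K 1) (K 1)) (cong (λ d → d + d + 1) (K₁-weight (const 1))))
    (trans (2*∑disc-⊍ (K 1) (K 1)) (cong (λ w → 2 * w + 2 * w + 4) (K₁-weight (λ k → k))))
  kind (node false (leaf x) r@(node b t u)) =
    strict (⊍-strict (K 1) ⟦ r ⟧ (complete (K-complete 1)) (kind r) z<s (size>0 r)
      (inj₂ (2≤size-node b t u)))
  kind (node false l@(node b t u) r) =
    strict (⊍-strict ⟦ l ⟧ ⟦ r ⟧ (kind l) (kind r) (size>0 l) (size>0 r) (inj₁ (2≤size-node b t u)))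

  -- `big` means excess at least 3 and `tight` excess at least 2. The second condition of `tight`
  -- amounts to Φ(1) < 3·2ⁿ⁻²; the skillet misses it by one, having exactly 2ⁿ⁻² - 1 disconnected
  -- sets.
  data Verdict (G : Graph n) : Set where
    big     : 3 + 2 * ∑disc G ≤ n + n * #disc G → Verdict G
    tight   : 2 + 2 * ∑disc G ≤ n + n * #disc G → 2 ^ (n ∸ 2) ≤ #disc G → Verdict G
    isSkillet : G ≅ skillet n → Verdict G

  Verdict-≅ : {G : Graph m} {H : Graph n} → G ≅ H → Verdict G → Verdict H
  Verdict-≅ {m} {G = G} {H} G≅H v with refl ← ↔⇒≡ (_≅_.bijection G≅H) = go v
    where
    d≡ = weight-≅ (const 1) G≅H
    w≡ = weight-≅ (λ k → k) G≅H
    go : Verdict G → Verdict H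
    go (big p)     = big (subst₂ (λ w d → 3 + 2 * w ≤ m + m * d) w≡ d≡ p)
    go (tight p q) = tight (subst₂ (λ w d → 2 + 2 * w ≤ m + m * d) w≡ d≡ p) (subst (_ ≤_) d≡ q)
    go (isSkillet i) = isSkillet (≅-trans (≅-sym G≅H) i)

  cone-weight : ∀ ω (G : Graph n) → weight ω (K 1 ⋈ G) ≡ weight ω G
  cone-weight ω G = trans (weight-⋈ ω (K 1) G) (cong (_+ weight ω G) (K₁-weight ω))

  -- Here the excess is even at least n.
  big-from : (G : Graph n) → 3 ≤ n → 2 * ∑disc G ≤ n * #disc G → Verdict G
  big-from G n≥3 le = big (+-mono-≤ n≥3 le)

  module _ (G : Graph m) (H : Graph n) (kG : Kind G) (kH : Kind H) where

    -- A join improves the general coefficient m + n + 2 by one, down to the order of the cone over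
    -- it. This is what `verdict-cone-⋈` requires.
    2*∑disc-⋈≤ : 0 < m → 0 < n →
      2 * ∑disc (G ⋈ H) ≤ (m + n + 1) * #disc (G ⋈ H)
    2*∑disc-⋈≤ 0<m 0<n = begin
      2 * ∑disc (G ⋈ H)                     ≡⟨ 2*∑disc-⋈ G H ⟩
      2 * ∑disc G + 2 * ∑disc H             ≤⟨ +-mono-≤ (2*∑disc≤ kG) (2*∑disc≤ kH) ⟩
      (m + 2) * x + (n + 2) * y             ≤⟨ +-mono-≤ (*-monoˡ-≤ x m+2≤) (*-monoˡ-≤ y n+2≤) ⟩
      (m + n + 1) * x + (m + n + 1) * y     ≡⟨ sym (*-distribˡ-+ (m + n + 1) x y) ⟩
      (m + n + 1) * (x + y)                 ≡⟨ cong ((m + n + 1) *_) (sym (weight-⋈ (const 1) G H)) ⟩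
      (m + n + 1) * #disc (G ⋈ H)           ∎
      where
      open ≤-Reasoning
      x = #disc G
      y = #disc H
      m+2≤ : m + 2 ≤ m + n + 1
      m+2≤ = ≤-trans (+-monoʳ-≤ m (+-monoˡ-≤ 1 0<n)) (≤-reflexive (sym (+-assoc m n 1)))
      n+2≤ : n + 2 ≤ m + n + 1
      n+2≤ = ≤-trans (≤-trans (≤-reflexive (sym (+-assoc n 1 1))) (+-monoˡ-≤ 1 (+-monoʳ-≤ n 0<m)))
        (≤-reflexive (cong (_+ 1) (+-comm n m)))

    verdict-⋈ : 2 ≤ m → 2 ≤ n → Verdict (G ⋈ H)
    verdict-⋈ 2≤m 2≤n = big-from (G ⋈ H) (≤-trans (s≤s (s≤s (s≤s z≤n))) (+-mono-≤ 2≤m 2≤n)) le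
      where
      open ≤-Reasoning
      x = #disc G
      y = #disc H
      le : 2 * ∑disc (G ⋈ H) ≤ (m + n) * #disc (G ⋈ H)
      le = begin
        2 * ∑disc (G ⋈ H)             ≡⟨ 2*∑disc-⋈ G H ⟩
        2 * ∑disc G + 2 * ∑disc H     ≤⟨ +-mono-≤ (2*∑disc≤ kG) (2*∑disc≤ kH) ⟩
        (m + 2) * x + (n + 2) * y     ≤⟨ +-mono-≤ (*-monoˡ-≤ x (+-monoʳ-≤ m 2≤n))
                                          (*-monoˡ-≤ y (≤-trans (+-monoʳ-≤ n 2≤m)
                                            (≤-reflexive (+-comm n m)))) ⟩
        (m + n) * x + (m + n) * y     ≡⟨ sym (*-distribˡ-+ (m + n) x y) ⟩
        (m + n) * (x + y)             ≡⟨ cong ((m + n) *_) (sym (weight-⋈ (const 1) G H)) ⟩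
        (m + n) * #disc (G ⋈ H)       ∎

    verdict-cone-⋈ : 0 < m → 0 < n → Verdict (K 1 ⋈ (G ⋈ H))
    verdict-cone-⋈ 0<m 0<n = big-from (K 1 ⋈ (G ⋈ H)) (s≤s (+-mono-≤ 0<m 0<n)) le
      where
      le : 2 * ∑disc (K 1 ⋈ (G ⋈ H)) ≤ suc (m + n) * #disc (K 1 ⋈ (G ⋈ H))
      le = begin
        2 * ∑disc (K 1 ⋈ (G ⋈ H))             ≡⟨ cong (2 *_) (cone-weight (λ k → k) (G ⋈ H)) ⟩
        2 * ∑disc (G ⋈ H)                     ≤⟨ 2*∑disc-⋈≤ 0<m 0<n ⟩
        (m + n + 1) * #disc (G ⋈ H)           ≡⟨ cong₂ _*_ (+-comm (m + n) 1)
                                                   (sym (cone-weight (const 1) (G ⋈ H))) ⟩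
        suc (m + n) * #disc (K 1 ⋈ (G ⋈ H))   ∎
        where open ≤-Reasoning

    -- With X = N m and Y = N n, the excess of the cone over G ⊍ H is at least
    -- m + n + 1 + XY ∸ mY ∸ nX = m + n + 1 + (X ∸ m) (Y ∸ n) ∸ mn.
    cone-⊍-excess : ∀ k → 0 < m → 0 < n → k + (m * N n + n * N m) ≤ suc (m + n) + N m * N n →
      k + 2 * ∑disc (K 1 ⋈ (G ⊍ H)) ≤ suc (m + n) + suc (m + n) * #disc (K 1 ⋈ (G ⊍ H))
    cone-⊍-excess k 0<m 0<n le = begin
      k + 2 * ∑disc (K 1 ⋈ (G ⊍ H))
        ≡⟨ cong (k +_) (trans (cong (2 *_) (cone-weight (λ k → k) (G ⊍ H))) (2*∑disc-⊍ G H)) ⟩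
      k + (2 * ∑disc G + 2 * ∑disc H + (m * suc X * Y + n * suc Y * X))
        ≤⟨ +-monoʳ-≤ k (+-monoˡ-≤ _ (+-mono-≤ (2*∑disc≤ kG) (2*∑disc≤ kH))) ⟩
      k + ((m + 2) * x + (n + 2) * y + (m * suc X * Y + n * suc Y * X))
        ≤⟨ +-monoʳ-≤ k (+-monoˡ-≤ _ (+-mono-≤ (*-monoˡ-≤ x m+2≤) (*-monoˡ-≤ y n+2≤))) ⟩
      k + (suc (m + n) * x + suc (m + n) * y + (m * suc X * Y + n * suc Y * X))
        ≡⟨ expand k m n x y X Y ⟩
      suc (m + n) * x + suc (m + n) * y + (m + n) * (X * Y) + (k + (m * Y + n * X))
        ≤⟨ +-monoʳ-≤ _ le ⟩
      suc (m + n) * x + suc (m + n) * y + (m + n) * (X * Y) + (suc (m + n) + X * Y)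
        ≡⟨ regroup m n x y X Y ⟩
      suc (m + n) + suc (m + n) * (x + y + X * Y)
        ≡⟨ cong (λ d → suc (m + n) + suc (m + n) * d)
             (sym (trans (cone-weight (const 1) (G ⊍ H)) (#disc-⊍ G H))) ⟩
      suc (m + n) + suc (m + n) * #disc (K 1 ⋈ (G ⊍ H)) ∎
      where
      open ≤-Reasoning
      x = #disc G
      y = #disc H
      X = N m
      Y = N n
      m+2≤ : m + 2 ≤ suc (m + n)
      m+2≤ = ≤-trans (≤-reflexive (+-suc m 1)) (s≤s (+-monoʳ-≤ m 0<n))
      n+2≤ : n + 2 ≤ suc (m + n)
      n+2≤ = ≤-trans (≤-reflexive (+-suc n 1))
        (s≤s (≤-trans (+-monoʳ-≤ n 0<m) (≤-reflexive (+-comm n m))))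
      expand : ∀ k m n x y X Y →
        k + (suc (m + n) * x + suc (m + n) * y + (m * suc X * Y + n * suc Y * X)) ≡
        suc (m + n) * x + suc (m + n) * y + (m + n) * (X * Y) + (k + (m * Y + n * X))
      expand = solve-∀
      regroup : ∀ m n x y X Y →
        suc (m + n) * x + suc (m + n) * y + (m + n) * (X * Y) + (suc (m + n) + X * Y) ≡
        suc (m + n) + suc (m + n) * (x + y + X * Y)
      regroup = solve-∀

  -- For orders m′ = m + 1 and n′ = n + 1 with N m′ = m′ + p and N n′ = n′ + q, the quantity m′ + n′
  -- + 1 + p q - m′ n′ collapses to 2 + p q - m n.
  cross-excess : ∀ k m n p q → k + m * n ≤ 2 + p * q →
    k + (suc m * (suc n + q) + suc n * (suc m + p)) ≤
    suc (suc m + suc n) + (suc m + p) * (suc n + q)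
  cross-excess k m n p q le = begin
    k + (suc m * (suc n + q) + suc n * (suc m + p))
      ≡⟨ lhs k m n p q ⟩
    k + m * n + (m + n + 1 + suc m * suc n + suc m * q + suc n * p)
      ≤⟨ +-monoˡ-≤ _ le ⟩
    2 + p * q + (m + n + 1 + suc m * suc n + suc m * q + suc n * p)
      ≡⟨ rhs m n p q ⟩
    suc (suc m + suc n) + (suc m + p) * (suc n + q) ∎
    where
    open ≤-Reasoning
    lhs : ∀ k m n p q → k + (suc m * (suc n + q) + suc n * (suc m + p)) ≡
      k + m * n + (m + n + 1 + suc m * suc n + suc m * q + suc n * p)
    lhs = solve-∀
    rhs : ∀ m n p q → 2 + p * q + (m + n + 1 + suc m * suc n + suc m * q + suc n * p) ≡
      suc (suc m + suc n) + (suc m + p) * (suc n + q)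
    rhs = solve-∀

  -- At order 2 the surplus p = 1 is one below the order; from order 3 on it is at least the order.
  -- That unit separates `big` from `tight` in `verdict-cone-⊍`.
  surplus : ∀ m → ∃[ p ] N (2 + m) ≡ 2 + m + p × suc m ≤ p × (1 ≤ m → 2 + m ≤ p)
  surplus 0       = 1 , refl , ≤-refl , λ ()
  surplus (suc k) with p , eq ← m≤n⇒∃[o]m+o≡n (n≤N (3 + k)) =
    p , sym eq , ≤-trans (n≤1+n _) p≥ , λ _ → p≥
    where
    p≥ : 3 + k ≤ p
    p≥ = +-cancelˡ-≤ (3 + k) _ _ (subst₂ _≤_
      (cong (λ x → 3 + k + x) (+-identityʳ (3 + k))) (sym eq) (<⇒≤ (2n<N k)))

  verdict-cone-⊍ : (G : Graph m) (H : Graph n) → Kind G → Kind H → 2 ≤ m → 2 ≤ n →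
    Verdict (K 1 ⋈ (G ⊍ H))
  verdict-cone-⊍ {suc (suc m)} {suc (suc n)} G H kG kH (s≤s (s≤s _)) (s≤s (s≤s _))
    with p , eqp , p≥ , p> ← surplus m | q , eqq , q≥ , q> ← surplus n = go m n refl refl
    where
    big-if : suc (suc m * suc n) ≤ p * q → Verdict (K 1 ⋈ (G ⊍ H))
    big-if le = big (cone-⊍-excess G H kG kH 3 z<s z<s
      (subst₂ (λ X Y → 3 + ((2 + m) * Y + (2 + n) * X) ≤ suc (2 + m + (2 + n)) + X * Y)
        (sym eqp) (sym eqq) (cross-excess 3 (suc m) (suc n) p q (s≤s (s≤s le)))))

    go : ∀ m′ n′ → m ≡ m′ → n ≡ n′ → Verdict (K 1 ⋈ (G ⊍ H))
    -- Both sides have order 2 and the cone has order 5: the 3·3 sets meeting both sides already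
    -- exceed the required 2³.
    go 0 0 refl refl = tight (cone-⊍-excess G H kG kH 2 z<s z<s ≤-refl) 8≤
      where
      8≤ : 8 ≤ #disc (K 1 ⋈ (G ⊍ H))
      8≤ = subst (8 ≤_) (sym (trans (cone-weight (const 1) (G ⊍ H)) (#disc-⊍ G H)))
        (≤-trans (n≤1+n 8) (m≤n+m 9 (#disc G + #disc H)))
    -- From p ≥ m + 2 and q ≥ n + 1 one gets p q ≥ (m + 1)(n + 1) + (n + 1), which exceeds (m + 1)(n
    -- + 1).
    go (suc k) _ refl _ = big-if (≤-trans
      (+-monoˡ-≤ (suc m * suc n) (s≤s (z≤n {n}))) (*-mono-≤ (p> (s≤s z≤n)) q≥))
    go _ (suc k) _ refl = big-if (≤-trans
      (≤-trans (+-monoˡ-≤ (suc m * suc n) (s≤s (z≤n {m}))) (≤-reflexive (sym (*-suc (suc m) (suc n)))))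
      (*-mono-≤ p≥ (q> (s≤s z≤n))))

  #disc-cone-K₁⊍ : (H : Graph n) → #disc (K 1 ⋈ (K 1 ⊍ H)) ≡ #disc H + N n
  #disc-cone-K₁⊍ {n} H = begin
    #disc (K 1 ⋈ (K 1 ⊍ H))         ≡⟨ cone-weight (const 1) (K 1 ⊍ H) ⟩
    #disc (K 1 ⊍ H)                 ≡⟨ #disc-⊍ (K 1) H ⟩
    #disc (K 1) + #disc H + 1 * N n ≡⟨ cong₂ (λ x y → x + #disc H + y)
                                         (K₁-weight (const 1)) (*-identityˡ (N n)) ⟩
    #disc H + N n                   ∎
    where open ≡-Reasoning

  2*∑disc-cone-K₁⊍ : (H : Graph n) →
    2 * ∑disc (K 1 ⋈ (K 1 ⊍ H)) ≡ 2 * ∑disc H + (2 * N n + n * suc (N n))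
  2*∑disc-cone-K₁⊍ {n} H = begin
    2 * ∑disc (K 1 ⋈ (K 1 ⊍ H)) ≡⟨ cong (2 *_) (cone-weight (λ k → k) (K 1 ⊍ H)) ⟩
    2 * ∑disc (K 1 ⊍ H)         ≡⟨ 2*∑disc-⊍ (K 1) H ⟩
    2 * ∑disc (K 1) + 2 * ∑disc H + (1 * 2 * N n + n * suc (N n) * 1)
      ≡⟨ cong₂ (λ x y → 2 * x + 2 * ∑disc H + (2 * N n + y))
           (K₁-weight (λ k → k)) (*-identityʳ (n * suc (N n))) ⟩
    2 * ∑disc H + (2 * N n + n * suc (N n)) ∎
    where open ≡-Reasoning

  -- The pair here is the claw K₁ ⋈ 3K₁, which has the excess of the skillet.
  verdict-cone-K₁⊍ : (H : Graph n) → Kind H → Verdict (K 1 ⋈ (K 1 ⊍ H))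
  verdict-cone-K₁⊍ {n} H kH = go kH
    where
    Y = N n
    -- The excess of the cone is 2 plus the slack of `H` in the inequality 2 w ≤ (n + 2) #d, so a
    -- strict `H` gives 3 at once.
    excess≥ : ∀ k → k + 2 * ∑disc H ≤ (n + 2) * #disc H →
      2 + k + 2 * ∑disc (K 1 ⋈ (K 1 ⊍ H)) ≤ 2 + n + (2 + n) * #disc (K 1 ⋈ (K 1 ⊍ H))
    excess≥ k le = begin
      2 + k + 2 * ∑disc (K 1 ⋈ (K 1 ⊍ H)) ≡⟨ cong (2 + k +_) (2*∑disc-cone-K₁⊍ H) ⟩
      2 + k + (2 * ∑disc H + (2 * Y + n * suc Y))         ≡⟨ lhs k (∑disc H) Y n ⟩
      k + 2 * ∑disc H + (2 + 2 * Y + n * suc Y)           ≤⟨ +-monoˡ-≤ _ le ⟩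
      (n + 2) * #disc H + (2 + 2 * Y + n * suc Y)         ≡⟨ rhs (#disc H) Y n ⟩
      2 + n + (2 + n) * (#disc H + Y)                     ≡⟨ cong (λ x → 2 + n + (2 + n) * x)
                                                              (sym (#disc-cone-K₁⊍ H)) ⟩
      2 + n + (2 + n) * #disc (K 1 ⋈ (K 1 ⊍ H))           ∎
      where
      open ≤-Reasoning
      lhs : ∀ k w Y n → 2 + k + (2 * w + (2 * Y + n * suc Y)) ≡ k + 2 * w + (2 + 2 * Y + n * suc Y)
      lhs = solve-∀
      rhs : ∀ d Y n → (n + 2) * d + (2 + 2 * Y + n * suc Y) ≡ 2 + n + (2 + n) * (d + Y)
      rhs = solve-∀
    go : Kind H → Verdict (K 1 ⋈ (K 1 ⊍ H))
    go (complete c) = isSkillet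
      (≗ᴳ⇒≅ (combine-congʳ true (K 1) (combine-congʳ false (K 1) (complete⇒≗K {G = H} c))))
    -- The cone has order 4, and 1 + `N 2` = 4 = 2² meets the threshold exactly.
    go k@(pair refl dH _) = tight (excess≥ 0 (2*∑disc≤ k))
      (≤-reflexive (sym (trans (#disc-cone-K₁⊍ H) (cong (_+ 3) dH))))
    go (strict lt) = big (excess≥ 1 lt)

  -- Case analysis on the cotree of a connected cograph

  ⊤-++ : ∀ m n → ⊤ {m} ++ᵛ ⊤ {n} ≡ ⊤ {m + n}
  ⊤-++ 0       n = refl
  ⊤-++ (suc m) n = cong (inside ∷_) (⊤-++ m n)

  ⊤-Nonempty : 0 < n → Nonempty (⊤ {n})
  ⊤-Nonempty 0<n = fromℕ< 0<n , ∈⊤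

  ⊍-¬connected : (G : Graph m) (H : Graph n) → 0 < m → 0 < n → ¬ Connected (G ⊍ H)
  ⊍-¬connected {m} {n} G H 0<m 0<n c = ⊍-¬connectedOn G H (⊤-Nonempty 0<m) (⊤-Nonempty 0<n)
    (subst (ConnectedOn (G ⊍ H)) (sym (⊤-++ m n)) c)

  Connected-≅ : {G : Graph m} {H : Graph n} → G ≅ H → Connected G → Connected H
  Connected-≅ {G = G} {H} G≅H = Equivalence.to (connectedOn-⇔ G H to (to-injective π)
    (_≅_.preserves G≅H) (λ _ → mk⇔ (λ _ → ∈⊤) (λ _ → ∈⊤)) λ {y} _ → from y , strictlyInverseˡ y)
    where
    π = _≅_.bijection G≅H
    open Inverse π

  module _ (G : Graph n) (n≥3 : 3 ≤ n) where

    private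
      Represents : Cotree (Fin n) → Set
      Represents t = Realises G t × (∀ v → v ∈ᵗ t)

      to≅ : ∀ t → Represents t → ⟦ t ⟧ ≅ G
      to≅ t (real , all) = ⟦⟧≅ G t real all

      size≥3 : ∀ t → Represents t → 3 ≤ size t
      size≥3 t rep = subst (3 ≤_) (sym (↔⇒≡ (_≅_.bijection (to≅ t rep)))) n≥3

    -- Commutativity is applied to the cotree inside `G`: a K₁ on the right of a node is moved to
    -- the left and the swapped tree is realised by the same graph.
    Realises-swap : ∀ {b l r} → Realises G (node b l r) → Realises G (node b r l)
    Realises-swap (vl , vr , cross) = vr , vl , λ u∈ v∈ →
      proj₁ (cross v∈ u∈) ∘ sym , trans (adj-sym G _ _) (proj₂ (cross v∈ u∈))

    verdict-cone : ∀ x t → Represents (node true (leaf x) t) → Verdict G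
    verdict-cone x (leaf y) rep =
      contradiction (size≥3 (node true (leaf x) (leaf y)) rep) λ { (s≤s (s≤s ())) }
    verdict-cone x t@(node true l r) rep = Verdict-≅ (to≅ (node true (leaf x) t) rep)
      (verdict-cone-⋈ ⟦ l ⟧ ⟦ r ⟧ (kind l) (kind r) (size>0 l) (size>0 r))
    verdict-cone x t@(node false (leaf y) r) rep = Verdict-≅ (to≅ (node true (leaf x) t) rep)
      (verdict-cone-K₁⊍ ⟦ r ⟧ (kind r))
    verdict-cone x (node false l@(node _ _ _) (leaf y)) ((_ , vt , cross) , all) =
      Verdict-≅ (to≅ t (real , all′)) (verdict-cone-K₁⊍ ⟦ l ⟧ (kind l))
      where
      t = node true (leaf x) (node false (leaf y) l)
      real : Realises G t
      real = _ , Realises-swap {false} {l} {leaf y} vt , λ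
        { u∈ (inj₁ v∈) → cross u∈ (inj₂ v∈) ; u∈ (inj₂ v∈) → cross u∈ (inj₁ v∈) }
      all′ : ∀ v → v ∈ᵗ t
      all′ v with all v
      ... | inj₁ v∈        = inj₁ v∈
      ... | inj₂ (inj₁ v∈) = inj₂ (inj₂ v∈)
      ... | inj₂ (inj₂ v∈) = inj₂ (inj₁ v∈)
    verdict-cone x t@(node false l@(node b l₁ l₂) r@(node c r₁ r₂)) rep =
      Verdict-≅ (to≅ (node true (leaf x) t) rep)
        (verdict-cone-⊍ ⟦ l ⟧ ⟦ r ⟧ (kind l) (kind r) (2≤size-node b l₁ l₂) (2≤size-node c r₁ r₂))

    verdict-cotree : Connected G → ∀ t → Represents t → Verdict G
    verdict-cotree _ (leaf x) rep = contradiction (size≥3 (leaf x) rep) λ { (s≤s ()) }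
    verdict-cotree conn t@(node false l r) rep = contradiction
      (Connected-≅ (≅-sym (to≅ t rep)) conn)
      (⊍-¬connected ⟦ l ⟧ ⟦ r ⟧ (size>0 l) (size>0 r))
    verdict-cotree _ (node true (leaf x) r) rep = verdict-cone x r rep
    verdict-cotree _ (node true l@(node _ _ _) (leaf y)) (real , all) =
      verdict-cone y l (Realises-swap {true} {l} {leaf y} real , λ v → swap (all v))
    verdict-cotree _ t@(node true l@(node b l₁ l₂) r@(node c r₁ r₂)) rep =
      Verdict-≅ (to≅ t rep)
        (verdict-⋈ ⟦ l ⟧ ⟦ r ⟧ (kind l) (kind r) (2≤size-node b l₁ l₂) (2≤size-node c r₁ r₂))

  verdict : (G : Graph n) → 3 ≤ n → Connected G → Cograph G → Verdict G
  verdict {suc _} G n≥3 conn cograph with t , rep ← cograph⇒cotree G cograph =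
    verdict-cotree G n≥3 conn t rep

  -- Comparison of the mean with the bound

  -- With p = Φ′(1), s = Φ(1) and q = 3·2ⁿ⁻², the conclusion is n/2 + 1/q = (n q + 2)/(2 q) < p/s
  -- multiplied out; c is a lower bound for the excess.
  mean-bound-arith : ∀ {n p s q c} → n * s + c ≤ 2 * p → 2 * s < c * q → (n * q + 2) * s < p * (2 * q)
  mean-bound-arith {n} {p} {s} {q} {c} le lt = begin-strict
    (n * q + 2) * s       ≡⟨ split n q s ⟩
    n * s * q + 2 * s     <⟨ +-monoʳ-< (n * s * q) lt ⟩
    n * s * q + c * q     ≡⟨ sym (*-distribʳ-+ q (n * s) c) ⟩
    (n * s + c) * q       ≤⟨ *-monoˡ-≤ q le ⟩
    2 * p * q             ≡⟨ regroup p q ⟩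
    p * (2 * q)           ∎
    where
    open ≤-Reasoning
    split : ∀ n q s → (n * q + 2) * s ≡ n * s * q + 2 * s
    split = solve-∀
    regroup : ∀ p q → 2 * p * q ≡ p * (2 * q)
    regroup = solve-∀

  cancel-weight : ∀ {p w t c e} → 2 * p + 2 * w ≡ t + e → c + 2 * w ≤ e → t + c ≤ 2 * p
  cancel-weight {p} {w} {t} {c} {e} eq le = +-cancelʳ-≤ (2 * w) (t + c) (2 * p) (begin
    t + c + 2 * w   ≡⟨ +-assoc t c _ ⟩
    t + (c + 2 * w) ≤⟨ +-monoʳ-≤ t le ⟩
    t + e           ≡⟨ sym eq ⟩
    2 * p + 2 * w   ∎)
    where open ≤-Reasoning

  private
    p s : Graph n → ℕ
    p G = eval (derivative (Φ G)) 1
    s G = eval (Φ G) 1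

    2^[2+k] : ∀ k → 2 ^ (2 + k) ≡ 4 * 2 ^ k
    2^[2+k] k = solve-4 (2 ^ k)
      where
      solve-4 : ∀ x → 2 * (2 * x) ≡ 4 * x
      solve-4 = solve-∀

  -- Strictness in the first alternative serves twice: it gives the bound, and it excludes equality
  -- for every graph other than the skillet.
  outcome : ∀ k (G : Graph (2 + k)) → Verdict G →
    ((2 + k) * (3 * 2 ^ k) + 2) * s G < p G * (2 * (3 * 2 ^ k)) ⊎ G ≅ skillet (2 + k)
  outcome k G (isSkillet iso) = inj₂ iso
  outcome k G (big le) = inj₁ (mean-bound-arith {2 + k} {p G} {s G} {3 * 2 ^ k} {3}
    (cancel-weight {p G} {∑disc G} {(2 + k) * s G} (excess G) le) (begin-strict
    2 * s G                       ≤⟨ *-monoʳ-≤ 2 (m≤m+n (s G) (#disc G)) ⟩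
    2 * (s G + #disc G)           <⟨ *-monoʳ-< 2 (n<1+n _) ⟩
    2 * suc (s G + #disc G)       ≡⟨ cong (2 *_) (trans (Φ[1]+#disc G) (2^[2+k] k)) ⟩
    2 * (4 * 2 ^ k)               ≤⟨ m≤m+n _ (2 ^ k) ⟩
    2 * (4 * 2 ^ k) + 2 ^ k       ≡⟨ nine (2 ^ k) ⟩
    3 * (3 * 2 ^ k)               ∎))
    where
    open ≤-Reasoning
    nine : ∀ x → 2 * (4 * x) + x ≡ 3 * (3 * x)
    nine = solve-∀
  outcome k G (tight le Q≤d) = inj₁ (mean-bound-arith {2 + k} {p G} {s G} {3 * 2 ^ k} {2}
    (cancel-weight {p G} {∑disc G} {(2 + k) * s G} (excess G) le)
    (*-monoʳ-< 2 (+-cancelʳ-< (2 ^ k) (s G) (3 * 2 ^ k) (begin-strict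
      s G + 2 ^ k           ≤⟨ +-monoʳ-≤ (s G) Q≤d ⟩
      s G + #disc G         <⟨ n<1+n _ ⟩
      suc (s G + #disc G)   ≡⟨ trans (Φ[1]+#disc G) (2^[2+k] k) ⟩
      4 * 2 ^ k             ≡⟨ +-comm (2 ^ k) (3 * 2 ^ k) ⟩
      3 * 2 ^ k + 2 ^ k     ∎))))
    where open ≤-Reasoning

  -- An excess of exactly 2 makes the mean n/2 + 1/Φ(1), and here Φ(1) = 3·2ⁿ⁻²; this is the origin
  -- of the denominator in the bound.
  skillet-mean : ∀ k (G : Graph (2 + k)) → G ≅ skillet (2 + k) →
    ((2 + k) * (3 * 2 ^ k) + 2) * s G ≡ p G * (2 * (3 * 2 ^ k))
  skillet-mean k G iso = begin
    ((2 + k) * q + 2) * s G           ≡⟨ split (2 + k) q (s G) ⟩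
    (2 + k) * s G * q + 2 * s G       ≡⟨ cong (λ x → (2 + k) * s G * q + 2 * x) s≡q ⟩
    (2 + k) * s G * q + 2 * q         ≡⟨ sym (*-distribʳ-+ q ((2 + k) * s G) 2) ⟩
    ((2 + k) * s G + 2) * q           ≡⟨ cong (_* q) (sym 2p≡) ⟩
    2 * p G * q                       ≡⟨ regroup (p G) q ⟩
    p G * (2 * q)                     ∎
    where
    open ≡-Reasoning
    q = 3 * 2 ^ k
    Y = N k
    split : ∀ n q s → (n * q + 2) * s ≡ n * s * q + 2 * s
    split = solve-∀
    regroup : ∀ p q → 2 * p * q ≡ p * (2 * q)
    regroup = solve-∀
    d≡ : #disc G ≡ Y
    d≡ = begin
      #disc G                 ≡⟨ weight-≅ (const 1) {H = K 1 ⋈ (K 1 ⊍ K k)} iso ⟩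
      #disc (K 1 ⋈ (K 1 ⊍ K k))
                              ≡⟨ #disc-cone-K₁⊍ (K k) ⟩
      #disc (K k) + Y         ≡⟨ cong (_+ Y) (weight-complete (const 1) {G = K k} (K-complete k)) ⟩
      Y                       ∎
    w≡ : 2 * ∑disc G ≡ 2 * Y + k * suc Y
    w≡ = begin
      2 * ∑disc G                             ≡⟨ cong (2 *_)
        (weight-≅ (λ j → j) {H = K 1 ⋈ (K 1 ⊍ K k)} iso) ⟩
      2 * ∑disc (K 1 ⋈ (K 1 ⊍ K k))             ≡⟨ 2*∑disc-cone-K₁⊍ (K k) ⟩
      2 * ∑disc (K k) + (2 * Y + k * suc Y)
        ≡⟨ cong (λ x → 2 * x + (2 * Y + k * suc Y))
             (weight-complete (λ j → j) {G = K k} (K-complete k)) ⟩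
      2 * Y + k * suc Y                       ∎
    s≡q : s G ≡ q
    s≡q = +-cancelʳ-≡ (2 ^ k) (s G) q (begin
      s G + 2 ^ k           ≡⟨ cong (s G +_) (sym (suc-N k)) ⟩
      s G + suc Y           ≡⟨ +-suc (s G) Y ⟩
      suc (s G + Y)         ≡⟨ cong (λ d → suc (s G + d)) (sym d≡) ⟩
      suc (s G + #disc G)   ≡⟨ trans (Φ[1]+#disc G) (2^[2+k] k) ⟩
      4 * 2 ^ k             ≡⟨ +-comm (2 ^ k) q ⟩
      q + 2 ^ k             ∎)
    2p≡ : 2 * p G ≡ (2 + k) * s G + 2
    2p≡ = +-cancelʳ-≡ (2 * ∑disc G) (2 * p G) ((2 + k) * s G + 2) (begin
      2 * p G + 2 * ∑disc G                             ≡⟨ excess G ⟩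
      (2 + k) * s G + ((2 + k) + (2 + k) * #disc G)
        ≡⟨ cong (λ d → (2 + k) * s G + ((2 + k) + (2 + k) * d)) d≡ ⟩
      (2 + k) * s G + ((2 + k) + (2 + k) * Y)           ≡⟨ collect ((2 + k) * s G) k Y ⟩
      (2 + k) * s G + 2 + (2 * Y + k * suc Y)           ≡⟨ cong ((2 + k) * s G + 2 +_) (sym w≡) ⟩
      (2 + k) * s G + 2 + 2 * ∑disc G                   ∎)
      where
      collect : ∀ t k Y → t + ((2 + k) + (2 + k) * Y) ≡ t + 2 + (2 * Y + k * suc Y)
      collect = solve-∀

  private
    bound : (n q : ℕ) .{{_ : NonZero q}} → ℚ
    bound n q = ℤ.+ n / 2 ℚ.+ ℤ.+ 1 / q

    -- `mkℚᵘ` takes the denominator minus one: the successor of `q + suc (q + 0)` is `2 * suc q` by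
    -- computation.
    boundᵘ : (n q : ℕ) → ℚᵘ
    boundᵘ n q = mkℚᵘ (ℤ.+ (n * suc q + 2)) (q + suc (q + 0))

    toℚᵘ-bound : ∀ n q → ℚ.toℚᵘ (bound n (suc q)) ℚᵘ.≃ boundᵘ n q
    toℚᵘ-bound n q = ℚᵘ.≃-trans (ℚ.toℚᵘ-homo-+ (ℤ.+ n / 2) (ℤ.+ 1 / suc q)) (ℚᵘ.≃-trans
      (ℚᵘ.+-cong (ℚ.toℚᵘ-fromℚᵘ (mkℚᵘ (ℤ.+ n) 1)) (ℚ.toℚᵘ-fromℚᵘ (mkℚᵘ (ℤ.+ 1) q)))
      (ℚᵘ.≃-reflexive (cong (λ i → mkℚᵘ (i ℤ.+ ℤ.+ 2) (q + suc (q + 0))) (sym (ℤ.pos-* n (suc q))))))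

    toℚᵘ-/ : ∀ p s → ℚ.toℚᵘ (ℤ.+ p / suc s) ℚᵘ.≃ mkℚᵘ (ℤ.+ p) s
    toℚᵘ-/ p s = ℚ.toℚᵘ-fromℚᵘ (mkℚᵘ (ℤ.+ p) s)

  -- For unnormalised rationals the order is cross-multiplication by definition, so the comparison
  -- is carried out there.
  bound≤/ : ∀ n q p s .{{_ : NonZero q}} .{{_ : NonZero s}} →
    (n * q + 2) * s ≤ p * (2 * q) → bound n q ℚ.≤ ℤ.+ p / s
  bound≤/ n (suc q) p (suc s) le = ℚ.toℚᵘ-cancel-≤
    (ℚᵘ.≤-respˡ-≃ (ℚᵘ.≃-sym (toℚᵘ-bound n q)) (ℚᵘ.≤-respʳ-≃ (ℚᵘ.≃-sym (toℚᵘ-/ p s))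
      (*≤* (subst₂ ℤ._≤_ (ℤ.pos-* (n * suc q + 2) (suc s)) (ℤ.pos-* p (2 * suc q)) (ℤ.+≤+ le)))))

  /≡bound : ∀ n q p s .{{_ : NonZero q}} .{{_ : NonZero s}} →
    (ℤ.+ p / s ≡ bound n q) ⇔ ((n * q + 2) * s ≡ p * (2 * q))
  /≡bound n (suc q) p (suc s) = mk⇔
    (λ eq → cross (ℚᵘ.≃-trans (ℚᵘ.≃-sym (toℚᵘ-bound n q))
      (ℚᵘ.≃-trans (ℚᵘ.≃-reflexive (cong ℚ.toℚᵘ (sym eq))) (toℚᵘ-/ p s))))
    (λ eq → ℚ.toℚᵘ-injective (ℚᵘ.≃-trans (toℚᵘ-/ p s)
      (ℚᵘ.≃-trans (*≡* (sym (trans (sym (ℤ.pos-* (n * suc q + 2) (suc s)))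
        (trans (cong ℤ.+_ eq) (ℤ.pos-* p (2 * suc q)))))) (ℚᵘ.≃-sym (toℚᵘ-bound n q)))))
    where
    cross : boundᵘ n q ℚᵘ.≃ mkℚᵘ (ℤ.+ p) s → (n * suc q + 2) * suc s ≡ p * (2 * suc q)
    cross (*≡* eq) = ℤ.+-injective
      (trans (ℤ.pos-* (n * suc q + 2) (suc s)) (trans eq (sym (ℤ.pos-* p (2 * suc q)))))

open import Data.Integer using (+_)
open import Data.Rational using (_+_; _≥_)

theorem4p7 :
    ∀ (n : ℕ) (n≥3 : 3 ≤ n) (G : Graph n) → Connected G → Cograph G →
    let
      instance
        n≢0 : NonZero n
        n≢0 = >-nonZero (<-≤-trans z<s n≥3)
        d≢0 : NonZero (3 * 2 ^ (n ∸ 2))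
        d≢0 = m*n≢0 3 (2 ^ (n ∸ 2)) {{_}} {{m^n≢0 2 (n ∸ 2)}}
      bound = + n / 2 + + 1 / (3 * 2 ^ (n ∸ 2))
    in
      globalMean G ≥ bound × (globalMean G ≡ bound ⇔ G ≅ skillet n)
theorem4p7 1 (s≤s ())
theorem4p7 n@(suc (suc k)) n≥3 G connected cograph =
  bound≤/ n q p s {{q≢0}} {{Φ[1]-nonZero G}} at-least ,
  mk⇔ (λ eq → [ (λ lt → contradiction (Equivalence.to mean≡bound eq) (<⇒≢ lt)) , (λ iso → iso) ]′
                result)
      (λ iso → Equivalence.from mean≡bound (skillet-mean k G iso))
  where
  q = 3 * 2 ^ k
  p = eval (derivative (Φ G)) 1
  s = eval (Φ G) 1
  q≢0 : NonZero q
  q≢0 = m*n≢0 3 (2 ^ k) {{_}} {{m^n≢0 2 k}}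
  result = outcome k G (verdict G n≥3 connected cograph)
  mean≡bound = /≡bound n q p s {{q≢0}} {{Φ[1]-nonZero G}}
  at-least = [ <⇒≤ , (λ iso → ≤-reflexive (skillet-mean k G iso)) ]′ result
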